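{- (1) The theory $\mathrm{RCA}_0^{\Omega}+(\exists^2)$ proves $\mathrm{ATR}_{\mathbb{o}}^{\mathrm{st}}\leftrightarrow\mathrm{UATR}_{\mathbb{o}}^{\mathrm{st}}$. (2) The theory $\mathrm{RCA}_0^{\Omega}+\mathrm{QF\text{ - }AC}^{1,1}+(\exists^2)$ proves $$\mathrm{ATR}_{\mathbb{o}}\leftrightarrow\mathrm{UATR}_{\mathbb{o}}\leftrightarrow\mathrm{ATR}_{\mathbb{o}}^{\mathrm{st}}\leftrightarrow\mathrm{UATR}_{\mathbb{o}}^{\mathrm{st}}\leftrightarrow\mathrm{ATR}_{\mathbb{o}}^{*}.$$
   Context: BASE THEORY. Finite types: $0$ (natural numbers), $\sigma\to\tau$, and $\sigma^{*}$ (finite sequences of objects of type $\sigma$); $1=0\to 0$, $2=1\to 0$, $3=2\to 0$. Superscripts indicate types; tuples are coded as single objects where convenient. Equality $=_0$ is primitive; for $\tau=\tau_1\to\dots\to\tau_k\to 0$, $x=_\tau y$ means $(\forall z_1\dots z_k)(xz_1\dots z_k=_0 yz_1\dots z_k)$. $\mathrm{RCA}_0^{\omega}$ is Kohlenbach's higher-order base theory: classical arithmetic in all finite types with combinators, zero, successor, the recursor $R_0$ (primitive recursion with type $0$ values), quantifier-free induction, extensionality $x=_\rho y\to\varphi(x)=_\tau\varphi(y)$ for all $\varphi^{\rho\to\tau}$, and $\mathrm{QF\text{ - }AC}^{1,0}$, where $\mathrm{QF\text{ - }AC}^{\sigma,\tau}$ is $(\forall x^\sigma)(\exists y^\tau)A_0(x,y)\to(\exists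 F^{\sigma\to\tau})(\forall x)A_0(x,F(x))$ for quantifier-free $A_0$. $\mathrm{RCA}_0^{\Omega}$ extends $\mathrm{RCA}_0^{\omega}$ (with the types $\sigma^*$) by a predicate $\mathrm{st}$ ("is standard") for each type. A formula is internal if it does not contain $\mathrm{st}$; $(\forall^{\mathrm{st}}x)A$ is $(\forall x)(\mathrm{st}(x)\to A)$, $(\exists^{\mathrm{st}}x)A$ is $(\exists x)(\mathrm{st}(x)\wedge A)$; $N\in\Omega$ means $\neg\mathrm{st}(N^0)$; $A^{\mathrm{st}}$ is $A$ with all quantifiers (except bounded number quantifiers) relativised to $\mathrm{st}$. Axioms: (i) standardness respects equality, closed terms are standard, a standard functional applied to a standard object is standard, and numbers below a standard number are standard; (ii) Idealization: $(\forall^{\mathrm{st}}x^{\sigma^*})(\exists y^\tau)(\forall z\in x)\varphi(z,y)\to(\exists y)(\forall^{\mathrm{st}}z^{\sigma})\varphi(z,y)$ for internal $\varphi$; (iii) $\mathrm{HAC}_{\mathrm{int}}$: $(\forall^{\mathrm{st}}x^{\rho})(\exists^{\mathrm{st}}y^{\tau})\varphi(x,y)\to(\exists^{\mathrm{st}}\Phi^{\rho\to\tau^*})(\forall^{\mathrm{st}}x)(\exists y\in\Phi(x))\varphi(x,y)$ for internal $\varphi$; (iv) $\mathrm{PF\text{ - }TP}_\forall$: $(\forall^{\mathrm{st}}x^\tau)\varphi(x)\to(\forall x^\tau)\varphi(x)$ for internal $\varphi(x)$ with no parameters other than $x$; (v) for certain functionals uniquely specified by a parameter-free internal formula $D$ (e.g.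 the one in $(\exists^2)$), a constant $\Xi_0$ with the axiom $\mathrm{st}(\Xi_0)\wedge(\forall^{\mathrm{st}}\Xi)[D^{\mathrm{st}}(\Xi)\to \Xi_0$ and $\Xi$ agree on all standard inputs$]$; these constants do not count as parameters in (iv). NOTATION. Sets $X^1,Y^1$ are given by characteristic functions; $\overline{Y}k$ is the initial segment of (the characteristic function of) $Y$ of length $k$. $\mathrm{WO}(X)$ states that $X$ codes a countable linear order $\leq_X$ that is well-founded, i.e. has no infinite strictly descending sequence (a function $h^1$). For $f^1$ let $\theta(n,Y)\equiv(\forall k^0)[f(k,n,\overline{Y}k)=0]$. $H_f(X,Y)$ is the formula (Simpson) stating that $\leq_X$ is a linear order and $Y$ is the set of all pairs $(n,j)$ with $j\in\mathrm{field}(X)$ and $\theta(n,Y^j)$, where $Y^j=\{(m,i): i<_Xj\wedge(m,i)\in Y\}$. PRINCIPLES. $(\exists^2)$: $(\exists\varphi^2)(\forall g^1)[(\exists x^0)g(x)=0\leftrightarrow\varphi(g)=0]$. $\mathrm{ATR}_{\mathbb{o}}$: $(\forall f^1,X^1)[\mathrm{WO}(X)\to(\exists Y^1)H_f(X,Y)]$. $\mathrm{UATR}_{\mathbb{o}}$: $(\exists\Phi^{1\to1})(\forall f^1,X^1)[\mathrm{WO}(X)\to H_f(X,\Phi(f,X))]$. $\mathrm{ATR}_{\mathbb{o}}^*$: $(\forall^{\mathrm{st}}f^1,X^1)[\mathrm{WO}(X)\to(\exists^{\mathrm{st}}Y^1)H_f^{\mathrm{st}}(X,Y)]$. -}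

module Defs where

open import Data.Empty using (⊥)
open import Data.List using (List; []; _∷_; map)
open import Data.List.Membership.Propositional using (_∈_)
open import Data.List.Relation.Binary.Subset.Propositional using (_⊆_)
open import Data.List.Relation.Unary.Any using (here; there)
open import Data.Maybe using (Maybe; just; nothing)
open import Data.Product using (_×_; _,_)
open import Data.Sum using (_⊎_; inj₁; inj₂)
open import Data.Unit using (⊤; tt)
open import Relation.Binary.PropositionalEquality using (_≡_; refl)

infixr 30 _⇒_
infix  31 _*

data Ty : Set where
  o   : Ty
  _⇒_ : Ty → Ty → Ty
  _*  : Ty → Ty

pattern 𝟏 = o ⇒ o
pattern 𝟐 = 𝟏 ⇒ o

Ctx : Set
Ctx = List Ty

record Signature : Set₁ where
  field
    Name : Set
    type : Name → Ty

open Signature public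

∅ : Signature
∅ = record { Name = ⊥ ; type = λ () }

private variable
  Sg : Signature
  Γ Θ : Ctx
  ρ σ τ υ : Ty

-- A sequence of type σ * is presented by its length and its entries:
-- `build n f` is ⟨f 0, …, f (n − 1)⟩.  The values of `entry s i` for i beyond
-- the length of s are left unspecified.
data Const (Sg : Signature) : Ty → Set where
  K     : Const Sg (σ ⇒ τ ⇒ σ)
  S     : Const Sg ((ρ ⇒ σ ⇒ τ) ⇒ (ρ ⇒ σ) ⇒ ρ ⇒ τ)
  zero  : Const Sg o
  suc   : Const Sg (o ⇒ o)
  R₀    : Const Sg (o ⇒ o ⇒ (o ⇒ o ⇒ o) ⇒ o)
  len   : Const Sg (σ * ⇒ o)
  entry : Const Sg (σ * ⇒ o ⇒ σ)
  build : Const Sg (o ⇒ (o ⇒ σ) ⇒ σ *)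
  Ξ₀    : (n : Name Sg) → Const Sg (type Sg n)

infixl 35 _·_

data Term (Sg : Signature) (Γ : Ctx) : Ty → Set where
  var : σ ∈ Γ → Term Sg Γ σ
  con : Const Sg σ → Term Sg Γ σ
  _·_ : Term Sg Γ (σ ⇒ τ) → Term Sg Γ σ → Term Sg Γ τ

infix  20 _≐_
infixr 18 _∧_
infixr 17 _∨_
infixr 16 _⊃_
infix  15 _⇔_

data Formula (Sg : Signature) (Γ : Ctx) : Set where
  _≐_         : Term Sg Γ o → Term Sg Γ o → Formula Sg Γ
  st          : Term Sg Γ σ → Formula Sg Γ
  ⊥̇           : Formula Sg Γ
  _∧_ _∨_ _⊃_ : Formula Sg Γ → Formula Sg Γ → Formula Sg Γ
  ∀̇ ∃̇         : (σ : Ty) → Formula Sg (σ ∷ Γ) → Formula Sg Γ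

Sentence : Signature → Set
Sentence Sg = Formula Sg []

¬̇_ : Formula Sg Γ → Formula Sg Γ
¬̇ A = A ⊃ ⊥̇

_⇔_ : Formula Sg Γ → Formula Sg Γ → Formula Sg Γ
A ⇔ B = (A ⊃ B) ∧ (B ⊃ A)

lift : Γ ⊆ Θ → σ ∷ Γ ⊆ σ ∷ Θ
lift r (here p)  = here p
lift r (there x) = there (r x)

renᵗ : Γ ⊆ Θ → Term Sg Γ σ → Term Sg Θ σ
renᵗ r (var x) = var (r x)
renᵗ r (con c) = con c
renᵗ r (s · t) = renᵗ r s · renᵗ r t

ren : Γ ⊆ Θ → Formula Sg Γ → Formula Sg Θ
ren r (s ≐ t)  = renᵗ r s ≐ renᵗ r t
ren r (st t)   = st (renᵗ r t)
ren r ⊥̇        = ⊥̇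
ren r (A ∧ B)  = ren r A ∧ ren r B
ren r (A ∨ B)  = ren r A ∨ ren r B
ren r (A ⊃ B)  = ren r A ⊃ ren r B
ren r (∀̇ σ A)  = ∀̇ σ (ren (lift r) A)
ren r (∃̇ σ A)  = ∃̇ σ (ren (lift r) A)

↑ᵗ : Term Sg Γ σ → Term Sg (τ ∷ Γ) σ
↑ᵗ = renᵗ there

↑ : Formula Sg Γ → Formula Sg (τ ∷ Γ)
↑ = ren there

closedᵗ : Term Sg [] σ → Term Sg Γ σ
closedᵗ = renᵗ λ ()

closed : Sentence Sg → Formula Sg Γ
closed = ren λ ()

Subst : Signature → Ctx → Ctx → Set
Subst Sg Γ Θ = ∀ {σ} → σ ∈ Γ → Term Sg Θ σ

liftˢ : Subst Sg Γ Θ → Subst Sg (σ ∷ Γ) (σ ∷ Θ)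
liftˢ s (here refl) = var (here refl)
liftˢ s (there x)   = ↑ᵗ (s x)

subᵗ : Subst Sg Γ Θ → Term Sg Γ σ → Term Sg Θ σ
subᵗ s (var x) = s x
subᵗ s (con c) = con c
subᵗ s (t · u) = subᵗ s t · subᵗ s u

sub : Subst Sg Γ Θ → Formula Sg Γ → Formula Sg Θ
sub s (t ≐ u)  = subᵗ s t ≐ subᵗ s u
sub s (st t)   = st (subᵗ s t)
sub s ⊥̇        = ⊥̇
sub s (A ∧ B)  = sub s A ∧ sub s B
sub s (A ∨ B)  = sub s A ∨ sub s B
sub s (A ⊃ B)  = sub s A ⊃ sub s B
sub s (∀̇ σ A)  = ∀̇ σ (sub (liftˢ s) A)
sub s (∃̇ σ A)  = ∃̇ σ (sub (liftˢ s) A)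

single : Term Sg Γ σ → Subst Sg (σ ∷ Γ) Γ
single t (here refl) = t
single t (there x)   = var x

infix 45 _[_]

_[_] : Formula Sg (σ ∷ Γ) → Term Sg Γ σ → Formula Sg Γ
A [ t ] = sub (single t) A

infix 45 _⟦_⟧

_⟦_⟧ : Formula Sg (σ ∷ []) → Term Sg Γ σ → Formula Sg Γ
A ⟦ t ⟧ = sub (λ { (here refl) → t ; (there ()) }) A

v0 : Term Sg (σ ∷ Γ) σ
v0 = var (here refl)

v1 : Term Sg (τ ∷ σ ∷ Γ) σ
v1 = var (there (here refl))

v2 : Term Sg (υ ∷ τ ∷ σ ∷ Γ) σ
v2 = var (there (there (here refl)))

-- Bracket abstraction: lam t is the combinatory term for λx.t.
-- In abs, inj₁ u: the variable does not occur, and the term is u;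
-- inj₂ f: it may occur, and f is the abstraction.
abs : Term Sg (σ ∷ Γ) τ → Term Sg Γ τ ⊎ Term Sg Γ (σ ⇒ τ)

absApp : Term Sg Γ (σ ⇒ τ) ⊎ Term Sg Γ (ρ ⇒ σ ⇒ τ) →
         Term Sg Γ σ ⊎ Term Sg Γ (ρ ⇒ σ) →
         Term Sg Γ τ ⊎ Term Sg Γ (ρ ⇒ τ)
absApp (inj₁ s) (inj₁ t) = inj₁ (s · t)
absApp (inj₁ s) (inj₂ g) = inj₂ (con S · (con K · s) · g)
absApp (inj₂ f) (inj₁ t) = inj₂ (con S · f · (con K · t))
absApp (inj₂ f) (inj₂ g) = inj₂ (con S · f · g)

abs {σ = σ} (var (here refl)) =
  inj₂ (con S · con K · con (K {σ = σ} {τ = σ}))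
abs (var (there x)) = inj₁ (var x)
abs (con c)         = inj₁ (con c)
abs (s · t)         = absApp (abs s) (abs t)

unabs : Term Sg Γ τ ⊎ Term Sg Γ (σ ⇒ τ) → Term Sg Γ (σ ⇒ τ)
unabs (inj₁ t) = con K · t
unabs (inj₂ f) = f

lam : Term Sg (σ ∷ Γ) τ → Term Sg Γ (σ ⇒ τ)
lam t = unabs (abs t)

infixl 27 _+̇_ _∸̇_
infixl 28 _×̇_

0̇ 1̇ : Term Sg Γ o
0̇ = con zero
1̇ = con suc · con zero

ṡ : Term Sg Γ o → Term Sg Γ o
ṡ t = con suc · t

rec : Term Sg Γ o → Term Sg Γ o → Term Sg Γ (o ⇒ o ⇒ o) → Term Sg Γ o
rec n a f = con R₀ · n · a · f

-- In the recursion step, v1 is the previous value and v0 the index.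
plus pred∸ times : Term Sg Γ (o ⇒ o ⇒ o)
plus  = lam (lam (rec v0 v1 (lam (lam (ṡ v1)))))
pred∸ = lam (lam (rec v0 v1 (lam (lam (rec v1 0̇ (lam (lam v0)))))))
times = lam (lam (rec v0 0̇ (lam (lam (plus · v1 · var (there (there (there (here refl)))))))))

_+̇_ _∸̇_ _×̇_ : Term Sg Γ o → Term Sg Γ o → Term Sg Γ o
s +̇ t = plus  · s · t
s ∸̇ t = pred∸ · s · t
s ×̇ t = times · s · t

_≤̇_ _<̇_ : Term Sg Γ o → Term Sg Γ o → Formula Sg Γ
s ≤̇ t = s ∸̇ t ≐ 0̇
s <̇ t = ṡ s ≤̇ t

infix 20 _≤̇_ _<̇_

-- The pairing (i + j)² + i of second-order arithmetic.
pairing : Term Sg Γ (o ⇒ o ⇒ o)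
pairing = lam (lam ((v1 +̇ v0) ×̇ (v1 +̇ v0) +̇ v1))

pair : Term Sg Γ o → Term Sg Γ o → Term Sg Γ o
pair s t = pairing · s · t

-- Truth values of decidable conditions: 1 is true, 0 is false.
isTrue isFalse : Term Sg Γ (o ⇒ o)
isFalse = lam (1̇ ∸̇ v0)
isTrue  = lam (1̇ ∸̇ (1̇ ∸̇ v0))

equal : Term Sg Γ (o ⇒ o ⇒ o)
equal = lam (lam (1̇ ∸̇ ((v1 ∸̇ v0) +̇ (v0 ∸̇ v1))))

-- someBelow · n · h is true iff h i ≠ 0 for some i < n.
someBelow : Term Sg Γ (o ⇒ (o ⇒ o) ⇒ o)
someBelow = lam (lam (rec v1 0̇ (lam (lam
  (isTrue · (v1 +̇ v2 · v0))))))

-- Tuples ⟨f , X⟩ of objects of type 1, coded as a single object of type 1: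
-- ⟨f , X⟩(2n) = f(n) and ⟨f , X⟩(2n+1) = X(n).
parity half : Term Sg Γ (o ⇒ o)
parity = lam (rec v0 0̇ (lam (lam (1̇ ∸̇ v1))))
half   = lam (rec v0 0̇ (lam (lam (v1 +̇ parity · v0))))

⟨_,_⟩ : Term Sg Γ 𝟏 → Term Sg Γ 𝟏 → Term Sg Γ 𝟏
⟨ f , X ⟩ = lam (rec (parity · v0) (↑ᵗ f · (half · v0))
                     (lam (lam (↑ᵗ (↑ᵗ (↑ᵗ X)) · (half · v2)))))

-- The code of Ȳk = ⟨Y 0, …, Y (k − 1)⟩: the empty sequence has code 0, and
-- s followed by a has code (s , a) + 1.
initial : Term Sg Γ 𝟏 → Term Sg Γ o → Term Sg Γ o
initial Y k = rec k 0̇ (lam (lam (ṡ (pair v1 (↑ᵗ (↑ᵗ Y) · v0)))))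

-- Objects of type σ * are equal if they have the same length and equal
-- entries below it.
Eq : (σ : Ty) → Term Sg Γ σ → Term Sg Γ σ → Formula Sg Γ
Eq o       s t = s ≐ t
Eq (σ ⇒ τ) s t = ∀̇ σ (Eq τ (↑ᵗ s · v0) (↑ᵗ t · v0))
Eq (σ *)   s t = (con len · s ≐ con len · t) ∧
  ∀̇ o (v0 <̇ con len · ↑ᵗ s ⊃
       Eq σ (con entry · ↑ᵗ s · v0) (con entry · ↑ᵗ t · v0))

_∈̇_ : Term Sg Γ σ → Term Sg Γ (σ *) → Formula Sg Γ
z ∈̇ s = ∃̇ o (v0 <̇ con len · ↑ᵗ s ∧ Eq _ (con entry · ↑ᵗ s · v0) (↑ᵗ z))

infix 20 _∈̇_

Internal : Formula Sg Γ → Set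
Internal (s ≐ t) = ⊤
Internal (st t)  = ⊥
Internal ⊥̇       = ⊤
Internal (A ∧ B) = Internal A × Internal B
Internal (A ∨ B) = Internal A × Internal B
Internal (A ⊃ B) = Internal A × Internal B
Internal (∀̇ σ A) = Internal A
Internal (∃̇ σ A) = Internal A

QuantifierFree : Formula Sg Γ → Set
QuantifierFree (s ≐ t) = ⊤
QuantifierFree (st t)  = ⊥
QuantifierFree ⊥̇       = ⊤
QuantifierFree (A ∧ B) = QuantifierFree A × QuantifierFree B
QuantifierFree (A ∨ B) = QuantifierFree A × QuantifierFree B
QuantifierFree (A ⊃ B) = QuantifierFree A × QuantifierFree B
QuantifierFree (∀̇ σ A) = ⊥
QuantifierFree (∃̇ σ A) = ⊥

∀ˢᵗ ∃ˢᵗ : (σ : Ty) → Formula Sg (σ ∷ Γ) → Formula Sg Γ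
∀ˢᵗ σ A = ∀̇ σ (st v0 ⊃ A)
∃ˢᵗ σ A = ∃̇ σ (st v0 ∧ A)

-- Bounded number quantifiers are not primitive here.  Those occurring in a
-- formula are relativised too; this is only ever applied to formulas with
-- standard parameters, where the bounds are standard and the relativisation is
-- therefore immaterial (see `st-≤` below).
infix 45 _ˢᵗ

_ˢᵗ : Formula Sg Γ → Formula Sg Γ
(s ≐ t) ˢᵗ = s ≐ t
(st t)  ˢᵗ = st t
⊥̇       ˢᵗ = ⊥̇
(A ∧ B) ˢᵗ = A ˢᵗ ∧ B ˢᵗ
(A ∨ B) ˢᵗ = A ˢᵗ ∨ B ˢᵗ
(A ⊃ B) ˢᵗ = A ˢᵗ ⊃ B ˢᵗ
(∀̇ σ A) ˢᵗ = ∀ˢᵗ σ (A ˢᵗ)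
(∃̇ σ A) ˢᵗ = ∃ˢᵗ σ (A ˢᵗ)

-- A theory is given by its axioms, possibly with free variables (parameters);
-- these are understood as universally closed.
Theory : Signature → Set₁
Theory Sg = (Γ : Ctx) → Formula Sg Γ → Set

infix 10 _∣_⊢_ _⊢_

data _∣_⊢_ (T : Theory Sg) {Γ : Ctx} (Δ : List (Formula Sg Γ)) :
           Formula Sg Γ → Set where
  axiom : ∀ {A} → T Γ A → T ∣ Δ ⊢ A
  hyp   : ∀ {A} → A ∈ Δ → T ∣ Δ ⊢ A
  ⊃I    : ∀ {A B} → T ∣ A ∷ Δ ⊢ B → T ∣ Δ ⊢ A ⊃ B
  ⊃E    : ∀ {A B} → T ∣ Δ ⊢ A ⊃ B → T ∣ Δ ⊢ A → T ∣ Δ ⊢ B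
  ∧I    : ∀ {A B} → T ∣ Δ ⊢ A → T ∣ Δ ⊢ B → T ∣ Δ ⊢ A ∧ B
  ∧E₁   : ∀ {A B} → T ∣ Δ ⊢ A ∧ B → T ∣ Δ ⊢ A
  ∧E₂   : ∀ {A B} → T ∣ Δ ⊢ A ∧ B → T ∣ Δ ⊢ B
  ∨I₁   : ∀ {A B} → T ∣ Δ ⊢ A → T ∣ Δ ⊢ A ∨ B
  ∨I₂   : ∀ {A B} → T ∣ Δ ⊢ B → T ∣ Δ ⊢ A ∨ B
  ∨E    : ∀ {A B C} → T ∣ Δ ⊢ A ∨ B → T ∣ A ∷ Δ ⊢ C → T ∣ B ∷ Δ ⊢ C → T ∣ Δ ⊢ C
  raa   : ∀ {A} → T ∣ (¬̇ A) ∷ Δ ⊢ ⊥̇ → T ∣ Δ ⊢ A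
  ∀I    : ∀ {σ A} → T ∣ map ↑ Δ ⊢ A → T ∣ Δ ⊢ ∀̇ σ A
  ∀E    : ∀ {σ A} → T ∣ Δ ⊢ ∀̇ σ A → (t : Term Sg Γ σ) → T ∣ Δ ⊢ A [ t ]
  ∃I    : ∀ {σ A} (t : Term Sg Γ σ) → T ∣ Δ ⊢ A [ t ] → T ∣ Δ ⊢ ∃̇ σ A
  ∃E    : ∀ {σ A C} → T ∣ Δ ⊢ ∃̇ σ A → T ∣ A ∷ map ↑ Δ ⊢ ↑ C → T ∣ Δ ⊢ C
  ≐I    : ∀ {t} → T ∣ Δ ⊢ t ≐ t
  ≐E    : ∀ {s t} (A : Formula Sg (o ∷ Γ)) → T ∣ Δ ⊢ s ≐ t → T ∣ Δ ⊢ A [ s ] → T ∣ Δ ⊢ A [ t ]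

_⊢_ : Theory Sg → Sentence Sg → Set
T ⊢ A = T ∣ [] ⊢ A

infixl 12 _⊕_

_⊕_ : Theory Sg → Theory Sg → Theory Sg
(T ⊕ U) Γ A = T Γ A ⊎ U Γ A

⟪_⟫ : Sentence Sg → Theory Sg
⟪ A ⟫ Γ B = B ≡ closed A

-- A(0), ∀x (A(x) → A(Sx)) ⟹ ∀x A(x)
induction : Formula Sg (o ∷ Γ) → Formula Sg Γ
induction A = A [ 0̇ ] ⊃ ∀̇ o (A ⊃ ren (lift there) A [ ṡ v0 ]) ⊃ ∀̇ o A

-- In A, v1 is x and v0 is y; the conclusion replaces y by F x.
choice : (σ τ : Ty) → Formula Sg (τ ∷ σ ∷ Γ) → Formula Sg Γ
choice σ τ A =
  ∀̇ σ (∃̇ τ A) ⊃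
  ∃̇ (σ ⇒ τ) (∀̇ σ (ren (lift (lift there)) A [ v1 · v0 ]))

data QF-AC (Sg : Signature) (σ τ : Ty) (Γ : Ctx) : Formula Sg Γ → Set where
  qf-ac : (A : Formula Sg (τ ∷ σ ∷ Γ)) → QuantifierFree A →
          QF-AC Sg σ τ Γ (choice σ τ A)

data RCA₀ω (Sg : Signature) (Γ : Ctx) : Formula Sg Γ → Set where
  K-ax  : (s : Term Sg Γ σ) (t : Term Sg Γ τ) →
          RCA₀ω Sg Γ (Eq σ (con K · s · t) s)
  S-ax  : (s : Term Sg Γ (ρ ⇒ σ ⇒ τ)) (t : Term Sg Γ (ρ ⇒ σ)) (u : Term Sg Γ ρ) →
          RCA₀ω Sg Γ (Eq τ (con S · s · t · u) (s · u · (t · u)))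
  0≢suc : (t : Term Sg Γ o) → RCA₀ω Sg Γ (¬̇ (ṡ t ≐ 0̇))
  suc-injective : (s t : Term Sg Γ o) → RCA₀ω Sg Γ (ṡ s ≐ ṡ t ⊃ s ≐ t)
  R₀-zero : (y : Term Sg Γ o) (z : Term Sg Γ (o ⇒ o ⇒ o)) →
            RCA₀ω Sg Γ (con R₀ · 0̇ · y · z ≐ y)
  R₀-suc  : (x y : Term Sg Γ o) (z : Term Sg Γ (o ⇒ o ⇒ o)) →
            RCA₀ω Sg Γ (con R₀ · ṡ x · y · z ≐ z · (con R₀ · x · y · z) · x)
  len-build   : (n : Term Sg Γ o) (f : Term Sg Γ (o ⇒ σ)) →
                RCA₀ω Sg Γ (con len · (con build · n · f) ≐ n)
  entry-build : (n i : Term Sg Γ o) (f : Term Sg Γ (o ⇒ σ)) →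
                RCA₀ω Sg Γ (i <̇ n ⊃ Eq σ (con entry · (con build · n · f) · i) (f · i))
  qf-induction   : (A : Formula Sg (o ∷ Γ)) → QuantifierFree A → RCA₀ω Sg Γ (induction A)
  extensionality : (s t : Term Sg Γ ρ) (φ : Term Sg Γ (ρ ⇒ τ)) →
                   RCA₀ω Sg Γ (Eq ρ s t ⊃ Eq τ (φ · s) (φ · t))
  qf-ac¹⁰ : ∀ {A} → QF-AC Sg 𝟏 o Γ A → RCA₀ω Sg Γ A

record Specification : Set where
  field
    ty       : Ty
    D        : Formula ∅ (ty ∷ [])
    internal : Internal D
    unique   : RCA₀ω ∅ ⊢ ∀̇ ty (∀̇ ty (D ⟦ v1 ⟧ ⊃ D ⟦ v0 ⟧ ⊃ Eq ty v1 v0))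

open Specification public

-- (∃x) g(x) = 0 ↔ φ(g) = 0, with v0 = g and v1 = φ.
decidesZero : Formula Sg (𝟏 ∷ 𝟐 ∷ Γ)
decidesZero = ∃̇ o (v1 · v0 ≐ 0̇) ⇔ v1 · v0 ≐ 0̇

-- The matrix of (∃²) leaves the nonzero values of φ open, so it does not by
-- itself determine φ; the unique functional meant is the one with values 0, 1.
isE₂ : Formula Sg (𝟐 ∷ [])
isE₂ = ∀̇ 𝟏 (decidesZero ∧ (v1 · v0 ≐ 0̇ ∨ v1 · v0 ≐ 1̇))

E₂ : Specification
E₂ = record { ty = 𝟐 ; D = isE₂ ; internal = _
            ; unique = ∀I (∀I (⊃I (⊃I (∀I
                (∨E (∧E₂ (D₁ h₁))
                  (same (hyp h₀) (zero₂ (there h₀) (zero₁⁻ (there h₁) (hyp h₀))))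
                  (∨E (∧E₂ (D₂ (there h₀)))
                    (same (zero₁ (there (there h₁)) (zero₂⁻ (there (there h₀)) (hyp h₀))) (hyp h₀))
                    (same (hyp h₁) (hyp h₀)))))))) }
  where
  Γ₃ = 𝟏 ∷ 𝟐 ∷ 𝟐 ∷ []

  pattern h₀ = here refl
  pattern h₁ = there (here refl)

  φ₁g φ₂g : Term ∅ Γ₃ o
  φ₁g = v2 · v0
  φ₂g = v1 · v0

  spec : Term ∅ Γ₃ 𝟐 → Formula ∅ Γ₃
  spec t = isE₂ ⟦ t ⟧

  hasZero : Formula ∅ Γ₃
  hasZero = ∃̇ o (v1 · v0 ≐ 0̇)

  module _ {Δ : List (Formula ∅ Γ₃)} where
    D₁ : spec v2 ∈ Δ → RCA₀ω ∅ ∣ Δ ⊢ (hasZero ⇔ φ₁g ≐ 0̇) ∧ (φ₁g ≐ 0̇ ∨ φ₁g ≐ 1̇)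
    D₁ h = ∀E (hyp h) v0

    D₂ : spec v1 ∈ Δ → RCA₀ω ∅ ∣ Δ ⊢ (hasZero ⇔ φ₂g ≐ 0̇) ∧ (φ₂g ≐ 0̇ ∨ φ₂g ≐ 1̇)
    D₂ h = ∀E (hyp h) v0

    zero₁ : spec v2 ∈ Δ → RCA₀ω ∅ ∣ Δ ⊢ hasZero → RCA₀ω ∅ ∣ Δ ⊢ φ₁g ≐ 0̇
    zero₁ h = ⊃E (∧E₁ (∧E₁ (D₁ h)))

    zero₁⁻ : spec v2 ∈ Δ → RCA₀ω ∅ ∣ Δ ⊢ φ₁g ≐ 0̇ → RCA₀ω ∅ ∣ Δ ⊢ hasZero
    zero₁⁻ h = ⊃E (∧E₂ (∧E₁ (D₁ h)))

    zero₂ : spec v1 ∈ Δ → RCA₀ω ∅ ∣ Δ ⊢ hasZero → RCA₀ω ∅ ∣ Δ ⊢ φ₂g ≐ 0̇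
    zero₂ h = ⊃E (∧E₁ (∧E₁ (D₂ h)))

    zero₂⁻ : spec v1 ∈ Δ → RCA₀ω ∅ ∣ Δ ⊢ φ₂g ≐ 0̇ → RCA₀ω ∅ ∣ Δ ⊢ hasZero
    zero₂⁻ h = ⊃E (∧E₂ (∧E₁ (D₂ h)))

    same : {u : Term ∅ Γ₃ o} → RCA₀ω ∅ ∣ Δ ⊢ φ₁g ≐ u → RCA₀ω ∅ ∣ Δ ⊢ φ₂g ≐ u →
           RCA₀ω ∅ ∣ Δ ⊢ φ₁g ≐ φ₂g
    same p q = ≐E (↑ᵗ φ₁g ≐ v0) (≐E (v0 ≐ ↑ᵗ φ₂g) q ≐I) p

-- The functionals Ξ₀ with a constant: the one in (∃²), and an arbitrary further
-- family of uniquely specified ones.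
record Functionals : Set₁ where
  field
    Other : Set
    other : Other → Specification

  specification : Maybe Other → Specification
  specification nothing  = E₂
  specification (just n) = other n

  signature : Signature
  signature = record { Name = Maybe Other ; type = λ n → ty (specification n) }

open Functionals public

embedᵗ : Term ∅ Γ σ → Term Sg Γ σ
embedᵗ (var x)     = var x
embedᵗ (con K)     = con K
embedᵗ (con S)     = con S
embedᵗ (con zero)  = con zero
embedᵗ (con suc)   = con suc
embedᵗ (con R₀)    = con R₀
embedᵗ (con len)   = con len
embedᵗ (con entry) = con entry
embedᵗ (con build) = con build
embedᵗ (s · t)     = embedᵗ s · embedᵗ t

embed : Formula ∅ Γ → Formula Sg Γ
embed (s ≐ t) = embedᵗ s ≐ embedᵗ t
embed (st t)  = st (embedᵗ t)
embed ⊥̇       = ⊥̇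
embed (A ∧ B) = embed A ∧ embed B
embed (A ∨ B) = embed A ∨ embed B
embed (A ⊃ B) = embed A ⊃ embed B
embed (∀̇ σ A) = ∀̇ σ (embed A)
embed (∃̇ σ A) = ∃̇ σ (embed A)

-- In φ, v0 is z and v1 is y.
idealization : (σ τ : Ty) → Formula Sg (σ ∷ τ ∷ Γ) → Formula Sg Γ
idealization σ τ φ =
  ∀ˢᵗ (σ *) (∃̇ τ (∀̇ σ (v0 ∈̇ v2 ⊃ ren (lift (lift there)) φ))) ⊃
  ∃̇ τ (∀ˢᵗ σ φ)

-- In φ, v1 is x and v0 is y.
hacInt : (ρ τ : Ty) → Formula Sg (τ ∷ ρ ∷ Γ) → Formula Sg Γ
hacInt ρ τ φ =
  ∀ˢᵗ ρ (∃ˢᵗ τ φ) ⊃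
  ∃ˢᵗ (ρ ⇒ τ *) (∀ˢᵗ ρ (∃̇ τ (v0 ∈̇ v2 · v1 ∧ ren (lift (lift there)) φ)))

-- The context of φ makes x its only parameter; constants Ξ₀ may occur in it.
transfer : (τ : Ty) → Formula Sg (τ ∷ []) → Sentence Sg
transfer τ φ = ∀ˢᵗ τ φ ⊃ ∀̇ τ φ

-- st(Ξ₀) ∧ (∀ˢᵗ Ξ)[Dˢᵗ(Ξ) → Ξ₀ and Ξ agree on all standard inputs].
uniqueness : (F : Functionals) → Maybe (Other F) → Sentence (signature F)
uniqueness F n =
  st Ξ ∧ ∀ˢᵗ (ty d) (embed (D d) ˢᵗ ⊃ (Eq (ty d) (↑ᵗ Ξ) v0) ˢᵗ)
  where
  d = specification F n
  Ξ = con (Ξ₀ n)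

data RCA₀Ω (F : Functionals) (Γ : Ctx) : Formula (signature F) Γ → Set where
  rca₀ω : ∀ {A} → RCA₀ω (signature F) Γ A → RCA₀Ω F Γ A
  st-Eq : (s t : Term (signature F) Γ σ) → RCA₀Ω F Γ (Eq σ s t ⊃ st s ⊃ st t)
  st-closed : (t : Term (signature F) [] σ) → RCA₀Ω F Γ (st (closedᵗ {Γ = Γ} t))
  st-app : (s : Term (signature F) Γ (σ ⇒ τ)) (t : Term (signature F) Γ σ) →
           RCA₀Ω F Γ (st s ⊃ st t ⊃ st (s · t))
  st-≤ : (s t : Term (signature F) Γ o) → RCA₀Ω F Γ (s ≤̇ t ⊃ st t ⊃ st s)
  I : (φ : Formula (signature F) (σ ∷ τ ∷ Γ)) → Internal φ →
      RCA₀Ω F Γ (idealization σ τ φ)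
  HAC-int : (φ : Formula (signature F) (τ ∷ ρ ∷ Γ)) → Internal φ →
            RCA₀Ω F Γ (hacInt ρ τ φ)
  PF-TP∀ : (φ : Formula (signature F) (τ ∷ [])) → Internal φ →
           RCA₀Ω F Γ (closed (transfer τ φ))
  Ξ₀-ax : (n : Maybe (Other F)) → RCA₀Ω F Γ (closed (uniqueness F n))

module _ {Sg : Signature} where

  -- Sets are 0,1-valued characteristic functions.
  IsSet : Term Sg Γ 𝟏 → Formula Sg Γ
  IsSet X = ∀̇ o (↑ᵗ X · v0 ≐ 0̇ ∨ ↑ᵗ X · v0 ≐ 1̇)

  Mem : Term Sg Γ o → Term Sg Γ 𝟏 → Formula Sg Γ
  Mem n X = X · n ≐ 1̇

  LE LT : Term Sg Γ 𝟏 → Term Sg Γ o → Term Sg Γ o → Formula Sg Γ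
  LE X i j = Mem (pair i j) X
  LT X i j = LE X i j ∧ ¬̇ LE X j i

  Field : Term Sg Γ 𝟏 → Term Sg Γ o → Formula Sg Γ
  Field X i = LE X i i

  LO : Term Sg Γ 𝟏 → Formula Sg Γ
  LO X = IsSet X
       ∧ ∀̇ o (∀̇ o (LE X₂ v1 v0 ⊃ Field X₂ v1 ∧ Field X₂ v0))
       ∧ ∀̇ o (∀̇ o (∀̇ o (LE X₃ v2 v1 ∧ LE X₃ v1 v0 ⊃ LE X₃ v2 v0)))
       ∧ ∀̇ o (∀̇ o (LE X₂ v1 v0 ∧ LE X₂ v0 v1 ⊃ v1 ≐ v0))
       ∧ ∀̇ o (∀̇ o (Field X₂ v1 ∧ Field X₂ v0 ⊃ LE X₂ v1 v0 ∨ LE X₂ v0 v1))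
    where
    X₂ = ↑ᵗ (↑ᵗ X)
    X₃ = ↑ᵗ X₂

  WO : Term Sg Γ 𝟏 → Formula Sg Γ
  WO X = LO X ∧ ¬̇ ∃̇ 𝟏 (∀̇ o (LT (↑ᵗ (↑ᵗ X)) (v1 · ṡ v0) (v1 · v0)))

  -- The characteristic function of Yʲ = {(m , i) : i <_X j ∧ (m , i) ∈ Y}.  The
  -- components of p = (m , i) are at most p.
  section : Term Sg Γ 𝟏 → Term Sg Γ 𝟏 → Term Sg Γ o → Term Sg Γ 𝟏
  section X Y j = lam
    (equal · (↑ᵗ Y · v0) · 1̇ ×̇
     someBelow · ṡ v0 · lam            -- i
       (someBelow · ṡ v1 · lam         -- m
         (equal · v2 · pair v0 v1 ×̇
          equal · (X₃ · pair v1 j₃) · 1̇ ×̇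
          isFalse · (equal · (X₃ · pair j₃ v1) · 1̇))))
    where
    X₃ = ↑ᵗ (↑ᵗ (↑ᵗ X))
    j₃ = ↑ᵗ (↑ᵗ (↑ᵗ j))

  -- (∀k) f(k , n , Ȳk) = 0, the arguments of f being coded as (k , (n , Ȳk)).
  θ : Term Sg Γ 𝟏 → Term Sg Γ o → Term Sg Γ 𝟏 → Formula Sg Γ
  θ f n Y = ∀̇ o (↑ᵗ f · pair v0 (pair (↑ᵗ n) (initial (↑ᵗ Y) v0)) ≐ 0̇)

  H : (f X Y : Term Sg Γ 𝟏) → Formula Sg Γ
  H f X Y = LO X ∧ IsSet Y ∧
    ∀̇ o (Mem v0 (↑ᵗ Y) ⇔
      ∃̇ o (∃̇ o (v2 ≐ pair v1 v0 ∧ Field X₃ v0 ∧ θ f₃ v1 (section X₃ Y₃ v0))))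
    where
    f₃ = ↑ᵗ (↑ᵗ (↑ᵗ f))
    X₃ = ↑ᵗ (↑ᵗ (↑ᵗ X))
    Y₃ = ↑ᵗ (↑ᵗ (↑ᵗ Y))

∃² : Sentence Sg
∃² = ∃̇ 𝟐 (∀̇ 𝟏 decidesZero)

ATR : Sentence Sg
ATR = ∀̇ 𝟏 (∀̇ 𝟏 (WO v0 ⊃ ∃̇ 𝟏 (H v2 v1 v0)))

UATR : Sentence Sg
UATR = ∃̇ (𝟏 ⇒ 𝟏) (∀̇ 𝟏 (∀̇ 𝟏 (WO v0 ⊃ H v1 v0 (v2 · ⟨ v1 , v0 ⟩))))

ATR* : Sentence Sg
ATR* = ∀ˢᵗ 𝟏 (∀ˢᵗ 𝟏 (WO v0 ⊃ ∃ˢᵗ 𝟏 (H v2 v1 v0 ˢᵗ)))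

{-# OPTIONS --safe #-}

-- Contraposing PF-TP∀, whatever satisfies a parameter-free internal formula can
-- be taken standard.  Thus (∃²) yields a standard search functional, and with it
-- standard characteristic functions for arithmetical formulas, which are
-- therefore absolute at standard arguments.  Classically, ATR says that every
-- (f , X) with X a linear order has some (h , Y) such that h descends in X or
-- H_f(X , Y): the matrix of this ∀∃-statement is arithmetical, hence
-- quantifier-free relative to the characteristic functions.
--
-- Under ATRˢᵗ the pair can be taken standard, so HAC_int gives a finite list of
-- candidates, and searching the list gives UATRˢᵗ.  Given QF-AC¹¹, ATR yields a
-- functional Ψ choosing (h , Y), hence UATR.  What Ψ satisfies has no parameters,
-- so Ψ may be taken standard: then h and Y are standard for standard (f , X), and
-- ATRˢᵗ follows.  The ∀∃-statement has no parameters either, so it transfers from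
-- standard (f , X) to all, which leads from ATR* back to ATR.
module Submission where

open import Defs
open import Data.List using (List; []; _∷_; map)
open import Data.List.Membership.Propositional using (_∈_)
open import Data.List.Membership.Propositional.Properties using (∈-map⁺)
open import Data.List.Relation.Binary.Subset.Propositional using (_⊆_)
open import Data.List.Relation.Binary.Subset.Propositional.Properties using (map⁺; ∷⁺ʳ)
open import Data.List.Relation.Unary.All as All using (All; []; _∷_; lookup)
open import Data.List.Relation.Unary.All.Properties using (lookup-map)
open import Data.List.Relation.Unary.Any using (here; there)
open import Data.Product using (_×_; _,_)
open import Data.Sum using (inj₁; inj₂)
open import Data.Unit using (⊤)
open import Data.Empty using (⊥)
open import Function using (_∘_)
open import Relation.Binary.PropositionalEquality
  using (_≡_; refl; sym; trans; cong; cong₂; subst; subst₂)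

private variable
  Sg : Signature
  Γ Θ Ξ : Ctx
  ρ σ τ υ : Ty

-- Substitution

infixl 6 _▹_

-- An environment for the variables of a closure: successive β-steps extend it instead of composing
-- single substitutions.
_▹_ : Subst Sg Γ Θ → Term Sg Θ σ → Subst Sg (σ ∷ Γ) Θ
(s ▹ u) (here refl) = u
(s ▹ u) (there x)   = s x

renᵗ-∘ : (r : Θ ⊆ Ξ) (q : Γ ⊆ Θ) (t : Term Sg Γ σ) →
         renᵗ r (renᵗ q t) ≡ renᵗ (λ x → r (q x)) t
renᵗ-∘ r q (var x) = refl
renᵗ-∘ r q (con c) = refl
renᵗ-∘ r q (t · u) = cong₂ _·_ (renᵗ-∘ r q t) (renᵗ-∘ r q u)

subᵗ-renᵗ : (s : Subst Sg Θ Ξ) (r : Γ ⊆ Θ) (t : Term Sg Γ σ) →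
            subᵗ s (renᵗ r t) ≡ subᵗ (λ x → s (r x)) t
subᵗ-renᵗ s r (var x) = refl
subᵗ-renᵗ s r (con c) = refl
subᵗ-renᵗ s r (t · u) = cong₂ _·_ (subᵗ-renᵗ s r t) (subᵗ-renᵗ s r u)

renᵗ-subᵗ : (r : Θ ⊆ Ξ) (s : Subst Sg Γ Θ) (t : Term Sg Γ σ) →
            renᵗ r (subᵗ s t) ≡ subᵗ (λ x → renᵗ r (s x)) t
renᵗ-subᵗ r s (var x) = refl
renᵗ-subᵗ r s (con c) = refl
renᵗ-subᵗ r s (t · u) = cong₂ _·_ (renᵗ-subᵗ r s t) (renᵗ-subᵗ r s u)

subᵗ-∘ : (s : Subst Sg Θ Ξ) (q : Subst Sg Γ Θ) (t : Term Sg Γ σ) →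
         subᵗ s (subᵗ q t) ≡ subᵗ (λ x → subᵗ s (q x)) t
subᵗ-∘ s q (var x) = refl
subᵗ-∘ s q (con c) = refl
subᵗ-∘ s q (t · u) = cong₂ _·_ (subᵗ-∘ s q t) (subᵗ-∘ s q u)

_≗ˢ_ : Subst Sg Γ Θ → Subst Sg Γ Θ → Set
_≗ˢ_ {Γ = Γ} s q = ∀ {σ} (x : σ ∈ Γ) → s x ≡ q x

subᵗ-cong : {s q : Subst Sg Γ Θ} → s ≗ˢ q → (t : Term Sg Γ σ) → subᵗ s t ≡ subᵗ q t
subᵗ-cong e (var x) = e x
subᵗ-cong e (con c) = refl
subᵗ-cong e (t · u) = cong₂ _·_ (subᵗ-cong e t) (subᵗ-cong e u)

subᵗ-var : (t : Term Sg Γ σ) → subᵗ var t ≡ t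
subᵗ-var (var x) = refl
subᵗ-var (con c) = refl
subᵗ-var (t · u) = cong₂ _·_ (subᵗ-var t) (subᵗ-var u)

renᵗ-as-subᵗ : (r : Γ ⊆ Θ) (t : Term Sg Γ σ) → renᵗ r t ≡ subᵗ (λ x → var (r x)) t
renᵗ-as-subᵗ r (var x) = refl
renᵗ-as-subᵗ r (con c) = refl
renᵗ-as-subᵗ r (t · u) = cong₂ _·_ (renᵗ-as-subᵗ r t) (renᵗ-as-subᵗ r u)

single-↑ᵗ : (u : Term Sg Γ σ) (t : Term Sg Γ τ) → subᵗ (single u) (↑ᵗ t) ≡ t
single-↑ᵗ u t = trans (subᵗ-renᵗ (single u) there t) (subᵗ-var t)

liftˢ-cong : {s q : Subst Sg Γ Θ} → s ≗ˢ q → liftˢ {σ = σ} s ≗ˢ liftˢ q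
liftˢ-cong e (here refl) = refl
liftˢ-cong e (there x)   = cong ↑ᵗ (e x)

sub-cong : {s q : Subst Sg Γ Θ} → s ≗ˢ q → (A : Formula Sg Γ) → sub s A ≡ sub q A
sub-cong e (t ≐ u) = cong₂ _≐_ (subᵗ-cong e t) (subᵗ-cong e u)
sub-cong e (st t)  = cong st (subᵗ-cong e t)
sub-cong e ⊥̇       = refl
sub-cong e (A ∧ B) = cong₂ _∧_ (sub-cong e A) (sub-cong e B)
sub-cong e (A ∨ B) = cong₂ _∨_ (sub-cong e A) (sub-cong e B)
sub-cong e (A ⊃ B) = cong₂ _⊃_ (sub-cong e A) (sub-cong e B)
sub-cong e (∀̇ σ A) = cong (∀̇ σ) (sub-cong (liftˢ-cong e) A)
sub-cong e (∃̇ σ A) = cong (∃̇ σ) (sub-cong (liftˢ-cong e) A)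

liftˢ-var : liftˢ {Sg} {Γ} {σ = σ} var ≗ˢ var
liftˢ-var (here refl) = refl
liftˢ-var (there x)   = refl

sub-var : (A : Formula Sg Γ) → sub var A ≡ A
sub-var (t ≐ u) = cong₂ _≐_ (subᵗ-var t) (subᵗ-var u)
sub-var (st t)  = cong st (subᵗ-var t)
sub-var ⊥̇       = refl
sub-var (A ∧ B) = cong₂ _∧_ (sub-var A) (sub-var B)
sub-var (A ∨ B) = cong₂ _∨_ (sub-var A) (sub-var B)
sub-var (A ⊃ B) = cong₂ _⊃_ (sub-var A) (sub-var B)
sub-var (∀̇ σ A) = cong (∀̇ σ) (trans (sub-cong liftˢ-var A) (sub-var A))
sub-var (∃̇ σ A) = cong (∃̇ σ) (trans (sub-cong liftˢ-var A) (sub-var A))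

liftˢ-lift : (s : Subst Sg Θ Ξ) (r : Γ ⊆ Θ) →
             (λ x → liftˢ {σ = σ} s (lift r x)) ≗ˢ liftˢ (λ x → s (r x))
liftˢ-lift s r (here refl) = refl
liftˢ-lift s r (there x)   = refl

sub-ren : (s : Subst Sg Θ Ξ) (r : Γ ⊆ Θ) (A : Formula Sg Γ) →
          sub s (ren r A) ≡ sub (λ x → s (r x)) A
sub-ren s r (t ≐ u) = cong₂ _≐_ (subᵗ-renᵗ s r t) (subᵗ-renᵗ s r u)
sub-ren s r (st t)  = cong st (subᵗ-renᵗ s r t)
sub-ren s r ⊥̇       = refl
sub-ren s r (A ∧ B) = cong₂ _∧_ (sub-ren s r A) (sub-ren s r B)
sub-ren s r (A ∨ B) = cong₂ _∨_ (sub-ren s r A) (sub-ren s r B)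
sub-ren s r (A ⊃ B) = cong₂ _⊃_ (sub-ren s r A) (sub-ren s r B)
sub-ren s r (∀̇ σ A) =
  cong (∀̇ σ) (trans (sub-ren (liftˢ s) (lift r) A) (sub-cong (liftˢ-lift s r) A))
sub-ren s r (∃̇ σ A) =
  cong (∃̇ σ) (trans (sub-ren (liftˢ s) (lift r) A) (sub-cong (liftˢ-lift s r) A))

lift-liftˢ : (r : Θ ⊆ Ξ) (s : Subst Sg Γ Θ) →
             (λ x → renᵗ (lift r) (liftˢ {σ = σ} s x)) ≗ˢ liftˢ (λ x → renᵗ r (s x))
lift-liftˢ r s (here refl) = refl
lift-liftˢ r s (there x)   =
  trans (renᵗ-∘ (lift r) there (s x)) (sym (renᵗ-∘ there r (s x)))

ren-sub : (r : Θ ⊆ Ξ) (s : Subst Sg Γ Θ) (A : Formula Sg Γ) →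
          ren r (sub s A) ≡ sub (λ x → renᵗ r (s x)) A
ren-sub r s (t ≐ u) = cong₂ _≐_ (renᵗ-subᵗ r s t) (renᵗ-subᵗ r s u)
ren-sub r s (st t)  = cong st (renᵗ-subᵗ r s t)
ren-sub r s ⊥̇       = refl
ren-sub r s (A ∧ B) = cong₂ _∧_ (ren-sub r s A) (ren-sub r s B)
ren-sub r s (A ∨ B) = cong₂ _∨_ (ren-sub r s A) (ren-sub r s B)
ren-sub r s (A ⊃ B) = cong₂ _⊃_ (ren-sub r s A) (ren-sub r s B)
ren-sub r s (∀̇ σ A) =
  cong (∀̇ σ) (trans (ren-sub (lift r) (liftˢ s) A) (sub-cong (lift-liftˢ r s) A))
ren-sub r s (∃̇ σ A) =
  cong (∃̇ σ) (trans (ren-sub (lift r) (liftˢ s) A) (sub-cong (lift-liftˢ r s) A))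

subᵗ-↑ᵗ : (s : Subst Sg Γ Θ) (t : Term Sg Γ σ) →
          subᵗ (liftˢ {σ = τ} s) (↑ᵗ t) ≡ ↑ᵗ (subᵗ s t)
subᵗ-↑ᵗ s t = trans (subᵗ-renᵗ (liftˢ s) there t) (sym (renᵗ-subᵗ there s t))

liftˢ-∘ : (s : Subst Sg Θ Ξ) (q : Subst Sg Γ Θ) →
          (λ x → subᵗ (liftˢ {σ = σ} s) (liftˢ q x)) ≗ˢ liftˢ (λ x → subᵗ s (q x))
liftˢ-∘ s q (here refl) = refl
liftˢ-∘ s q (there x)   = subᵗ-↑ᵗ s (q x)

sub-∘ : (s : Subst Sg Θ Ξ) (q : Subst Sg Γ Θ) (A : Formula Sg Γ) →
        sub s (sub q A) ≡ sub (λ x → subᵗ s (q x)) A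
sub-∘ s q (t ≐ u) = cong₂ _≐_ (subᵗ-∘ s q t) (subᵗ-∘ s q u)
sub-∘ s q (st t)  = cong st (subᵗ-∘ s q t)
sub-∘ s q ⊥̇       = refl
sub-∘ s q (A ∧ B) = cong₂ _∧_ (sub-∘ s q A) (sub-∘ s q B)
sub-∘ s q (A ∨ B) = cong₂ _∨_ (sub-∘ s q A) (sub-∘ s q B)
sub-∘ s q (A ⊃ B) = cong₂ _⊃_ (sub-∘ s q A) (sub-∘ s q B)
sub-∘ s q (∀̇ σ A) =
  cong (∀̇ σ) (trans (sub-∘ (liftˢ s) (liftˢ q) A) (sub-cong (liftˢ-∘ s q) A))
sub-∘ s q (∃̇ σ A) =
  cong (∃̇ σ) (trans (sub-∘ (liftˢ s) (liftˢ q) A) (sub-cong (liftˢ-∘ s q) A))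

-- Eigenvariable bookkeeping: this turns the instance at the freshly bound variable, as `∀E` and
-- `∃I` handle it, back into the body of the quantifier.
single-v0 : (A : Formula Sg (σ ∷ Γ)) → ren (lift there) A [ v0 ] ≡ A
single-v0 A = trans (sub-ren (single v0) (lift there) A)
  (trans (sub-cong (λ { (here refl) → refl ; (there x) → refl }) A) (sub-var A))

-- `Eq` recurses on the type, so at a variable type substitution does not compute on it; the
-- recursion is repeated here.
sub-Eq : (s : Subst Sg Γ Θ) (σ : Ty) {t u : Term Sg Γ σ} →
         sub s (Eq σ t u) ≡ Eq σ (subᵗ s t) (subᵗ s u)
sub-Eq s o       = refl
sub-Eq s (σ ⇒ τ) {t} {u} = cong (∀̇ σ) (trans (sub-Eq (liftˢ s) τ)
  (cong₂ (λ a b → Eq τ (a · v0) (b · v0)) (subᵗ-↑ᵗ s t) (subᵗ-↑ᵗ s u)))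
sub-Eq s (σ *)   {t} {u} = cong (λ A → (con len · subᵗ s t ≐ con len · subᵗ s u) ∧ ∀̇ o A)
  (cong₂ _⊃_ (cong (λ a → v0 <̇ con len · a) (subᵗ-↑ᵗ s t))
    (trans (sub-Eq (liftˢ s) σ)
      (cong₂ (λ a b → Eq σ (con entry · a · v0) (con entry · b · v0))
        (subᵗ-↑ᵗ s t) (subᵗ-↑ᵗ s u))))

-- Derivations in RCA₀ω

pattern h0 = here refl
pattern h1 = there h0
pattern h2 = there h1
pattern h3 = there h2
pattern h4 = there h3

v3 : Term Sg (ρ ∷ υ ∷ τ ∷ σ ∷ Γ) σ
v3 = var (there (there (there (here refl))))

double : Term Sg Γ (o ⇒ o)
double = lam (rec v0 0̇ (lam (lam (ṡ (ṡ v1)))))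

-- The projections of the tuple code: they read off the even and the odd places of a function.
leftF rightF : Term Sg Γ (𝟏 ⇒ 𝟏)
leftF  = lam (lam (v1 · (double · v0)))
rightF = lam (lam (v1 · ṡ (double · v0)))

predecessor : Term Sg Γ (o ⇒ o)
predecessor = lam (rec v0 0̇ (lam (lam v0)))

ifZero : Term Sg Γ o → Term Sg Γ o → Term Sg Γ o → Term Sg Γ o
ifZero n a b = rec n a (con K · (con K · b))

Arithmetical : Formula Sg Γ → Set
Arithmetical (s ≐ t) = ⊤
Arithmetical (st t)  = ⊥
Arithmetical ⊥̇       = ⊤
Arithmetical (A ∧ B) = Arithmetical A × Arithmetical B
Arithmetical (A ∨ B) = Arithmetical A × Arithmetical B
Arithmetical (A ⊃ B) = Arithmetical A × Arithmetical B
Arithmetical (∀̇ o A) = Arithmetical A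
Arithmetical (∀̇ _ A) = ⊥
Arithmetical (∃̇ o A) = Arithmetical A
Arithmetical (∃̇ _ A) = ⊥

-- The two numbers to be compared are handed over as the values at 0 and 1 of one function, so that
-- the test is a functional of type 2 and within reach of QF-AC¹⁰.
Decides= : 𝟐 ∈ Γ → Formula Sg Γ
Decides= e = ∀̇ 𝟏 (var (there e) · v0 ≐ 0̇ ⇔ v0 · 0̇ ≐ v0 · 1̇)

-- Feferman's search operator μ, except that the zero returned need not be the least.
FindsZero : 𝟐 ∈ Γ → Formula Sg Γ
FindsZero m = ∀̇ o (∀̇ 𝟏 (v0 · v1 ≐ 0̇ ⊃ v0 · (var (there (there m)) · v0) ≐ 0̇))

decide= : 𝟐 ∈ Γ → Term Sg Γ o → Term Sg Γ o → Term Sg Γ o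
decide= e s t = var e · lam (ifZero v0 (↑ᵗ s) (↑ᵗ t))

not : Term Sg Γ o → Term Sg Γ o
not a = ifZero a 1̇ 0̇

witness : 𝟐 ∈ Γ → Term Sg (o ∷ Γ) o → Term Sg Γ o
witness m t = var m · lam t

-- Here 0 codes truth.  The values at ∃n A and ∀n A are those of A at the number
-- that the search functional m assigns to A, and to its negation.
χ : (A : Formula Sg Γ) → Arithmetical A → (e m : 𝟐 ∈ Γ) → Term Sg Γ o
χ (s ≐ t) _ e m       = decide= e s t
χ ⊥̇ _ e m             = 1̇
χ (A ∧ B) (a , b) e m = ifZero (χ A a e m) (χ B b e m) 1̇
χ (A ∨ B) (a , b) e m = ifZero (χ A a e m) 0̇ (χ B b e m)
χ (A ⊃ B) (a , b) e m = ifZero (χ A a e m) (χ B b e m) 0̇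
χ (∀̇ o A) a e m       = subᵗ (single (witness m (not t))) t
  where t = χ A a (there e) (there m)
χ (∃̇ o A) a e m       = subᵗ (single (witness m t)) t
  where t = χ A a (there e) (there m)

module Derivability {Sg : Signature} (T : Theory Sg) (ω : ∀ {Γ A} → RCA₀ω Sg Γ A → T Γ A) where

  private variable
    Δ Δ′ : List (Formula Sg Γ)
    A B C : Formula Sg Γ
    s t u : Term Sg Γ σ

  -- Structural and derived rules of the calculus

  weaken : Δ ⊆ Δ′ → T ∣ Δ ⊢ A → T ∣ Δ′ ⊢ A
  weaken i (axiom a)    = axiom a
  weaken i (hyp h)      = hyp (i h)
  weaken i (⊃I p)       = ⊃I (weaken (∷⁺ʳ _ i) p)
  weaken i (⊃E p q)     = ⊃E (weaken i p) (weaken i q)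
  weaken i (∧I p q)     = ∧I (weaken i p) (weaken i q)
  weaken i (∧E₁ p)      = ∧E₁ (weaken i p)
  weaken i (∧E₂ p)      = ∧E₂ (weaken i p)
  weaken i (∨I₁ p)      = ∨I₁ (weaken i p)
  weaken i (∨I₂ p)      = ∨I₂ (weaken i p)
  weaken i (∨E p q r)   = ∨E (weaken i p) (weaken (∷⁺ʳ _ i) q) (weaken (∷⁺ʳ _ i) r)
  weaken i (raa p)      = raa (weaken (∷⁺ʳ _ i) p)
  weaken i (∀I p)       = ∀I (weaken (map⁺ ↑ i) p)
  weaken i (∀E p t)     = ∀E (weaken i p) t
  weaken i (∃I t p)     = ∃I t (weaken i p)
  weaken i (∃E p q)     = ∃E (weaken i p) (weaken (∷⁺ʳ _ (map⁺ ↑ i)) q)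
  weaken i ≐I           = ≐I
  weaken i (≐E A p q)   = ≐E A (weaken i p) (weaken i q)

  wk : T ∣ Δ ⊢ A → T ∣ B ∷ Δ ⊢ A
  wk = weaken there

  exFalso : T ∣ Δ ⊢ ⊥̇ → T ∣ Δ ⊢ A
  exFalso p = raa (wk p)

  cut : T ∣ Δ ⊢ A → T ∣ A ∷ Δ ⊢ B → T ∣ Δ ⊢ B
  cut p q = ⊃E (⊃I q) p

  byCases : (A : Formula Sg Γ) → T ∣ A ∷ Δ ⊢ B → T ∣ ¬̇ A ∷ Δ ⊢ B → T ∣ Δ ⊢ B
  byCases A p q = raa (⊃E (hyp (here refl)) (⊃E (⊃I (weaken (∷⁺ʳ _ there) q))
    (⊃I (⊃E (hyp (there (here refl))) (weaken (∷⁺ʳ _ there) p)))))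

  ⊃-trans : T ∣ Δ ⊢ A ⊃ B → T ∣ Δ ⊢ B ⊃ C → T ∣ Δ ⊢ A ⊃ C
  ⊃-trans p q = ⊃I (⊃E (wk q) (⊃E (wk p) (hyp (here refl))))

  ⇔-trans : T ∣ Δ ⊢ A ⇔ B → T ∣ Δ ⊢ B ⇔ C → T ∣ Δ ⊢ A ⇔ C
  ⇔-trans p q = ∧I (⊃-trans (∧E₁ p) (∧E₁ q)) (⊃-trans (∧E₂ q) (∧E₂ p))

  -- Leibniz's rule up to propositional equality of formulas: an instance of a weakened term does
  -- not reduce to the term itself.
  ≐E′ : (A : Formula Sg (o ∷ Γ)) → A [ s ] ≡ B → A [ t ] ≡ C →
        T ∣ Δ ⊢ s ≐ t → T ∣ Δ ⊢ B → T ∣ Δ ⊢ C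
  ≐E′ A refl refl p q = ≐E A p q

  ≐-sym : T ∣ Δ ⊢ s ≐ t → T ∣ Δ ⊢ t ≐ s
  ≐-sym {s = s} {t = t} p =
    ≐E′ (v0 ≐ ↑ᵗ s) (cong (s ≐_) (single-↑ᵗ s s)) (cong (t ≐_) (single-↑ᵗ t s)) p ≐I

  ≐-trans : T ∣ Δ ⊢ s ≐ t → T ∣ Δ ⊢ t ≐ u → T ∣ Δ ⊢ s ≐ u
  ≐-trans {s = s} {t = t} {u = u} p q =
    ≐E′ (↑ᵗ s ≐ v0) (cong (_≐ t) (single-↑ᵗ t s)) (cong (_≐ u) (single-↑ᵗ u s)) q p

  ∀-hyp : {A : Formula Sg (σ ∷ Γ)} → ∀̇ σ A ∈ Δ → T ∣ map ↑ Δ ⊢ A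
  ∀-hyp {A = A} h = subst (T ∣ _ ⊢_) (single-v0 A) (∀E (hyp (∈-map⁺ ↑ h)) v0)

  -- Equality in all finite types

  Eq-refl : ∀ σ {t} → T ∣ Δ ⊢ Eq σ t t
  Eq-refl o       = ≐I
  Eq-refl (σ ⇒ τ) = ∀I (Eq-refl τ)
  Eq-refl (σ *)   = ∧I ≐I (∀I (⊃I (Eq-refl σ)))

  <-cong : T ∣ Δ ⊢ t ≐ u → T ∣ Δ ⊢ s <̇ t → T ∣ Δ ⊢ s <̇ u
  <-cong {t = t} {u = u} {s = s} =
    ≐E′ (↑ᵗ s <̇ v0) (cong (_<̇ t) (single-↑ᵗ t s)) (cong (_<̇ u) (single-↑ᵗ u s))

  Eq-sym : ∀ σ {s t} → T ∣ Δ ⊢ Eq σ s t ⊃ Eq σ t s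
  Eq-sym o       = ⊃I (≐-sym (hyp (here refl)))
  Eq-sym (σ ⇒ τ) = ⊃I (∀I (⊃E (Eq-sym τ) (∀-hyp (here refl))))
  Eq-sym (σ *)   = ⊃I (∧I (≐-sym (∧E₁ (hyp (here refl))))
    (cut (∧E₂ (hyp (here refl))) (∀I (⊃I (⊃E (Eq-sym σ) (⊃E (wk (∀-hyp (here refl)))
      (<-cong (≐-sym (∧E₁ (hyp (there (there (here refl)))))) (hyp (here refl)))))))))

  Eq-trans : ∀ σ {s t u} → T ∣ Δ ⊢ Eq σ s t ⊃ Eq σ t u ⊃ Eq σ s u
  Eq-trans o       = ⊃I (⊃I (≐-trans (hyp (there (here refl))) (hyp (here refl))))
  Eq-trans (σ ⇒ τ) = ⊃I (⊃I (∀I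
    (⊃E (⊃E (Eq-trans τ) (∀-hyp (there (here refl)))) (∀-hyp (here refl)))))
  Eq-trans (σ *)   = ⊃I (⊃I (∧I
    (≐-trans (∧E₁ (hyp (there (here refl)))) (∧E₁ (hyp (here refl))))
    (cut (∧E₂ (hyp (there (here refl)))) (cut (∧E₂ (hyp (there (here refl)))) (∀I (⊃I
      (⊃E (⊃E (Eq-trans σ) (⊃E (wk (∀-hyp (there (here refl)))) (hyp (here refl))))
        (⊃E (wk (∀-hyp (here refl)))
          -- The second equation concerns indices below the length of the middle sequence, so the
          -- bound is first moved along the equality of lengths.
          (<-cong (∧E₁ (hyp (there (there (there (there (here refl))))))) (hyp (here refl)))))))))))

  infixr 5 _⟫_

  _⟫_ : {s t u : Term Sg Γ σ} → T ∣ Δ ⊢ Eq σ s t → T ∣ Δ ⊢ Eq σ t u → T ∣ Δ ⊢ Eq σ s u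
  p ⟫ q = ⊃E (⊃E (Eq-trans _) p) q

  flip : {s t : Term Sg Γ σ} → T ∣ Δ ⊢ Eq σ s t → T ∣ Δ ⊢ Eq σ t s
  flip p = ⊃E (Eq-sym _) p

  Eq-appˡ : {f g : Term Sg Γ (σ ⇒ τ)} → T ∣ Δ ⊢ Eq (σ ⇒ τ) f g → (t : Term Sg Γ σ) →
            T ∣ Δ ⊢ Eq τ (f · t) (g · t)
  Eq-appˡ {τ = τ} {f = f} {g = g} p t = subst (T ∣ _ ⊢_)
    (trans (sub-Eq (single t) τ)
      (cong₂ (λ a b → Eq τ (a · t) (b · t)) (single-↑ᵗ t f) (single-↑ᵗ t g)))
    (∀E p t)

  Eq-app : {f g : Term Sg Γ (σ ⇒ τ)} {s t : Term Sg Γ σ} →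
           T ∣ Δ ⊢ Eq (σ ⇒ τ) f g → T ∣ Δ ⊢ Eq σ s t → T ∣ Δ ⊢ Eq τ (f · s) (g · t)
  Eq-app {g = g} {s} {t} p q = Eq-appˡ p s ⟫ ⊃E (axiom (ω (extensionality s t g))) q

  -- β-reduction inside a closure: the abstraction stands under a substitution.
  β : (q : Subst Sg Γ Θ) (t : Term Sg (σ ∷ Γ) τ) (u : Term Sg Θ σ) {Δ : List (Formula Sg Θ)} →
      T ∣ Δ ⊢ Eq τ (subᵗ q (lam t) · u) (subᵗ (q ▹ u) t)
  β q (var (here refl)) u = axiom (ω (S-ax _ _ _)) ⟫ axiom (ω (K-ax _ _))
  β q (var (there x)) u   = axiom (ω (K-ax _ _))
  β q (con c) u           = axiom (ω (K-ax _ _))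
  β q (t₁ · t₂) u with abs t₁ | abs t₂ | β q t₁ u | β q t₂ u
  -- Here the abstraction is `K` applied to the whole application, while the induction hypotheses
  -- concern `K` applied to each factor; each factor is expanded before its hypothesis is used.
  ... | inj₁ _ | inj₁ _ | p₁ | p₂ = axiom (ω (K-ax _ _)) ⟫ Eq-app
    (flip (axiom (ω (K-ax _ u))) ⟫ p₁) (flip (axiom (ω (K-ax _ u))) ⟫ p₂)
  ... | inj₁ _ | inj₂ _ | p₁ | p₂ = axiom (ω (S-ax _ _ _)) ⟫ Eq-app p₁ p₂
  ... | inj₂ _ | inj₁ _ | p₁ | p₂ = axiom (ω (S-ax _ _ _)) ⟫ Eq-app p₁ p₂
  ... | inj₂ _ | inj₂ _ | p₁ | p₂ = axiom (ω (S-ax _ _ _)) ⟫ Eq-app p₁ p₂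

  β₂ : (q : Subst Sg Γ Θ) (t : Term Sg (σ ∷ ρ ∷ Γ) τ) (a : Term Sg Θ ρ) (b : Term Sg Θ σ) →
       {Δ : List (Formula Sg Θ)} →
       T ∣ Δ ⊢ Eq τ (subᵗ q (lam (lam t)) · a · b) (subᵗ (q ▹ a ▹ b) t)
  β₂ q t a b = Eq-appˡ (β q (lam t) a) b ⟫ β (q ▹ a) t b

  -- Recursion and the coding of pairs of functions

  rec-cong : (a : Term Sg Γ o) (f : Term Sg Γ (o ⇒ o ⇒ o)) →
             T ∣ Δ ⊢ s ≐ t → T ∣ Δ ⊢ rec s a f ≐ rec t a f
  rec-cong a f p = Eq-appˡ (Eq-appˡ (Eq-app (Eq-refl _) p) a) f

  rec-zero : (a : Term Sg Γ o) (f : Term Sg Γ (o ⇒ o ⇒ o)) → T ∣ Δ ⊢ rec 0̇ a f ≐ a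
  rec-zero a f = axiom (ω (R₀-zero a f))

  -- The step function is a closure, so one unfolding of the recursion lands in the environment
  -- extended by the previous value and the index.
  rec-suc : (q : Subst Sg Γ Θ) (n a : Term Sg Θ o) (t : Term Sg (o ∷ o ∷ Γ) o) →
            {Δ : List (Formula Sg Θ)} →
            T ∣ Δ ⊢ rec (ṡ n) a (subᵗ q (lam (lam t))) ≐
                    subᵗ (q ▹ rec n a (subᵗ q (lam (lam t))) ▹ n) t
  rec-suc q n a t = axiom (ω (R₀-suc n a _)) ⟫ β₂ q t (rec n a (subᵗ q (lam (lam t)))) n

  ṡ-cong : T ∣ Δ ⊢ s ≐ t → T ∣ Δ ⊢ ṡ s ≐ ṡ t
  ṡ-cong p = Eq-app (Eq-refl _) p

  +̇-β : (s t : Term Sg Γ o) → T ∣ Δ ⊢ s +̇ t ≐ rec t s (lam (lam (ṡ v1)))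
  +̇-β s t = β₂ var (rec v0 v1 (lam (lam (ṡ v1)))) s t

  +̇-zero : (s : Term Sg Γ o) → T ∣ Δ ⊢ s +̇ 0̇ ≐ s
  +̇-zero s = +̇-β s 0̇ ⟫ rec-zero _ _

  +̇-suc : (s t : Term Sg Γ o) → T ∣ Δ ⊢ s +̇ ṡ t ≐ ṡ (s +̇ t)
  +̇-suc s t = +̇-β s (ṡ t) ⟫ rec-suc var t s (ṡ v1) ⟫ ṡ-cong (flip (+̇-β s t))

  +̇-cong : {a b c d : Term Sg Γ o} → T ∣ Δ ⊢ a ≐ b → T ∣ Δ ⊢ c ≐ d → T ∣ Δ ⊢ a +̇ c ≐ b +̇ d
  +̇-cong p q = Eq-app (Eq-app (Eq-refl _) p) q

  ∸̇-cong : {a b c d : Term Sg Γ o} → T ∣ Δ ⊢ a ≐ b → T ∣ Δ ⊢ c ≐ d → T ∣ Δ ⊢ a ∸̇ c ≐ b ∸̇ d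
  ∸̇-cong p q = Eq-app (Eq-app (Eq-refl _) p) q

  private
    step : Term Sg (o ∷ o ∷ Γ) o
    step = rec v1 0̇ (lam (lam v0))

  ∸̇-β : (s t : Term Sg Γ o) → T ∣ Δ ⊢ s ∸̇ t ≐ rec t s (lam (lam step))
  ∸̇-β s t = β₂ var (rec v0 v1 (lam (lam step))) s t

  ∸̇-zero : (s : Term Sg Γ o) → T ∣ Δ ⊢ s ∸̇ 0̇ ≐ s
  ∸̇-zero s = ∸̇-β s 0̇ ⟫ rec-zero _ _

  -- Parity flips by subtraction from 1; together with `∸̇-zero` this covers both of its values.
  1∸1 : T ∣ Δ ⊢ 1̇ {Sg} {Γ} ∸̇ 1̇ ≐ 0̇
  1∸1 = ∸̇-β 1̇ 1̇ ⟫ rec-suc var 0̇ 1̇ step ⟫ rec-cong 0̇ _ (rec-zero 1̇ _)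
    ⟫ rec-suc var 0̇ 0̇ v0

  parity-zero : T ∣ Δ ⊢ parity {Sg} {Γ} · 0̇ ≐ 0̇
  parity-zero = β var (rec v0 0̇ (lam (lam (1̇ ∸̇ v1)))) 0̇ ⟫ rec-zero _ _

  parity-suc : (n : Term Sg Γ o) → T ∣ Δ ⊢ parity · ṡ n ≐ 1̇ ∸̇ (parity · n)
  parity-suc n = β var body (ṡ n) ⟫ rec-suc var n 0̇ (1̇ ∸̇ v1)
    ⟫ ∸̇-cong ≐I (flip (β var body n))
    where body = rec v0 0̇ (lam (lam (1̇ ∸̇ v1)))

  half-zero : T ∣ Δ ⊢ half {Sg} {Γ} · 0̇ ≐ 0̇
  half-zero = β var (rec v0 0̇ (lam (lam (v1 +̇ parity · v0)))) 0̇ ⟫ rec-zero _ _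

  half-suc : (n : Term Sg Γ o) → T ∣ Δ ⊢ half · ṡ n ≐ half · n +̇ parity · n
  half-suc n = β var body (ṡ n) ⟫ rec-suc var n 0̇ (v1 +̇ parity · v0)
    ⟫ +̇-cong (flip (β var body n)) ≐I
    where body = rec v0 0̇ (lam (lam (v1 +̇ parity · v0)))

  double-zero : T ∣ Δ ⊢ double {Sg} {Γ} · 0̇ ≐ 0̇
  double-zero = β var (rec v0 0̇ (lam (lam (ṡ (ṡ v1))))) 0̇ ⟫ rec-zero _ _

  double-suc : (n : Term Sg Γ o) → T ∣ Δ ⊢ double · ṡ n ≐ ṡ (ṡ (double · n))
  double-suc n = β var body (ṡ n) ⟫ rec-suc var n 0̇ (ṡ (ṡ v1))
    ⟫ ṡ-cong (ṡ-cong (flip (β var body n)))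
    where body = rec v0 0̇ (lam (lam (ṡ (ṡ v1))))

  parity-even : {d : Term Sg Γ o} → T ∣ Δ ⊢ parity · d ≐ 0̇ → T ∣ Δ ⊢ parity · ṡ d ≐ 1̇
  parity-even {d = d} p = parity-suc d ⟫ ∸̇-cong ≐I p ⟫ ∸̇-zero 1̇

  half-even : {d : Term Sg Γ o} → T ∣ Δ ⊢ parity · d ≐ 0̇ → T ∣ Δ ⊢ half · ṡ d ≐ half · d
  half-even {d = d} p = half-suc d ⟫ +̇-cong ≐I p ⟫ +̇-zero _

  private
    halves : Formula Sg (o ∷ Γ)
    halves = parity · (double · v0) ≐ 0̇ ∧ half · (double · v0) ≐ v0

  ap : (f : Term Sg Γ (σ ⇒ τ)) {s t : Term Sg Γ σ} → T ∣ Δ ⊢ Eq σ s t → T ∣ Δ ⊢ Eq τ (f · s) (f · t)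
  ap f p = Eq-app (Eq-refl _) p

  -- Both equations go through one induction because `half` advances by the current parity: from an
  -- even number, two successors bring the parity back to 0 and raise the half by exactly one.
  parity-half-double : T ∣ Δ ⊢ ∀̇ o (halves {Γ = Γ})
  parity-half-double = ⊃E (⊃E (axiom (ω (qf-induction halves _)))
    (∧I (ap _ double-zero ⟫ parity-zero) (ap _ double-zero ⟫ half-zero)))
    (∀I (⊃I (∧I
      (ap _ (double-suc v0) ⟫ parity-suc _ ⟫ ∸̇-cong ≐I (parity-even even) ⟫ 1∸1)
      (ap _ (double-suc v0) ⟫ half-suc _ ⟫ +̇-cong (half-even even ⟫ halved) (parity-even even)
        ⟫ +̇-suc v0 0̇ ⟫ ṡ-cong (+̇-zero v0)))))
    where
    even   = ∧E₁ (hyp h0)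
    halved = ∧E₂ (hyp h0)

  parity-double : (n : Term Sg Γ o) → T ∣ Δ ⊢ parity · (double · n) ≐ 0̇
  parity-double n = ∧E₁ (∀E parity-half-double n)

  half-double : (n : Term Sg Γ o) → T ∣ Δ ⊢ half · (double · n) ≐ n
  half-double n = ∧E₂ (∀E parity-half-double n)

  private
    select : 𝟏 ∈ Γ → 𝟏 ∈ Γ → Term Sg (o ∷ Γ) o
    select x y = rec (parity · v0) (var (there x) · (half · v0))
      (lam (lam (var (there (there (there y))) · (half · v2))))

  -- Stated for variables, whose weakenings and substitution instances compute, so that the β-steps
  -- need no transport along equations between terms.
  left-⟨⟩ : (x y : 𝟏 ∈ Γ) → T ∣ Δ ⊢ Eq 𝟏 (leftF · ⟨ var x , var y ⟩) (var x)
  left-⟨⟩ x y = ∀I (Eq-appˡ (β var (lam (v1 · (double · v0))) pr) v0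
    ⟫ β (var ▹ pr) (v1 · (double · v0)) v0
    ⟫ β var (select (there x) (there y)) (double · v0)
    ⟫ rec-cong _ _ (parity-double v0)
    ⟫ rec-zero _ _
    ⟫ ap _ (half-double v0))
    where pr = ⟨ var (there x) , var (there y) ⟩

  right-⟨⟩ : (x y : 𝟏 ∈ Γ) → T ∣ Δ ⊢ Eq 𝟏 (rightF · ⟨ var x , var y ⟩) (var y)
  right-⟨⟩ x y = ∀I (Eq-appˡ (β var (lam (v1 · ṡ (double · v0))) pr) v0
    ⟫ β (var ▹ pr) (v1 · ṡ (double · v0)) v0
    ⟫ β var (select (there x) (there y)) (ṡ (double · v0))
    ⟫ rec-cong _ _ (parity-even (parity-double v0))
    ⟫ rec-suc (var ▹ ṡ (double · v0)) 0̇ _ (var (there (there (there (there y)))) · (half · v2))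
    ⟫ ap _ (half-even (parity-double v0) ⟫ half-double v0))
    where pr = ⟨ var (there x) , var (there y) ⟩

  ifZero-zero : (a b : Term Sg Γ o) {n : Term Sg Γ o} → T ∣ Δ ⊢ n ≐ 0̇ → T ∣ Δ ⊢ ifZero n a b ≐ a
  ifZero-zero a b p = rec-cong _ _ p ⟫ rec-zero _ _

  predecessor-suc : (n : Term Sg Γ o) → T ∣ Δ ⊢ predecessor · ṡ n ≐ n
  predecessor-suc n = β var (rec v0 0̇ (lam (lam v0))) (ṡ n) ⟫ rec-suc var n 0̇ v0

  -- `predecessor` names the witness in the successor case, which keeps the induction formula
  -- quantifier-free.
  zero∨suc : T ∣ Δ ⊢ ∀̇ {Γ = Γ} o (v0 ≐ 0̇ ∨ v0 ≐ ṡ (predecessor · v0))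
  zero∨suc = ⊃E (⊃E (axiom (ω (qf-induction _ _))) (∨I₁ ≐I))
    (∀I (⊃I (∨I₂ (ṡ-cong (flip (predecessor-suc v0))))))

  ifZero-suc : (a b n : Term Sg Γ o) → T ∣ Δ ⊢ ifZero (ṡ n) a b ≐ b
  ifZero-suc a b n = axiom (ω (R₀-suc _ _ _)) ⟫ Eq-appˡ (axiom (ω (K-ax _ _))) n
    ⟫ axiom (ω (K-ax _ _))

  ifZero-nonzero : (a b : Term Sg Γ o) {n : Term Sg Γ o} →
                   T ∣ Δ ⊢ ¬̇ (n ≐ 0̇) → T ∣ Δ ⊢ ifZero n a b ≐ b
  ifZero-nonzero a b {n} p = ∨E (∀E zero∨suc n)
    (exFalso (⊃E (wk p) (hyp h0)))
    (rec-cong _ _ (hyp h0) ⟫ ifZero-suc a b _)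

  β₁ : (t : Term Sg (σ ∷ Γ) τ) (u : Term Sg Γ σ) →
       T ∣ Δ ⊢ Eq τ (lam t · u) (subᵗ (single u) t)
  β₁ {τ = τ} t u = subst₂ (λ a b → T ∣ _ ⊢ Eq τ (a · u) b) (subᵗ-var (lam t))
    (subᵗ-cong (λ { (here refl) → refl ; (there x) → refl }) t) (β var t u)

  lam-v0 : (t : Term Sg (σ ∷ Γ) τ) → T ∣ Δ ⊢ Eq τ (↑ᵗ (lam t) · v0) t
  lam-v0 {τ = τ} t = subst₂ (λ a b → T ∣ _ ⊢ Eq τ (a · v0) b)
    (sym (renᵗ-as-subᵗ there (lam t)))
    (trans (subᵗ-cong (λ { (here refl) → refl ; (there x) → refl }) t) (subᵗ-var t))
    (β (λ x → var (there x)) t v0)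

  ∃-v0 : {A : Formula Sg (σ ∷ Γ)} {Δ : List (Formula Sg (σ ∷ Γ))} →
         T ∣ Δ ⊢ A → T ∣ Δ ⊢ ↑ (∃̇ σ A)
  ∃-v0 {A = A} p = ∃I v0 (subst (T ∣ _ ⊢_) (sym (single-v0 A)) p)

  -- Truth values of arithmetical formulas

  1≢0 : T ∣ Δ ⊢ ¬̇ (1̇ {Sg} {Γ} ≐ 0̇)
  1≢0 = axiom (ω (0≢suc _))

  infix 4 _∣_⊨_by_

  _∣_⊨_by_ : (Γ : Ctx) → List (Formula Sg Γ) → Formula Sg Γ → Term Sg Γ o → Set
  Γ ∣ Δ ⊨ A by a = T ∣ Δ ⊢ A ⇔ a ≐ 0̇

  by-⊥ : Γ ∣ Δ ⊨ ⊥̇ by 1̇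
  by-⊥ = ∧I (⊃I (exFalso (hyp h0))) 1≢0

  module _ {A B : Formula Sg Γ} {Δ : List (Formula Sg Γ)} {a b : Term Sg Γ o}
           (p : Γ ∣ Δ ⊨ A by a) (q : Γ ∣ Δ ⊨ B by b) where

    private
      A⇒a : ∀ {Δ′} → Δ ⊆ Δ′ → T ∣ Δ′ ⊢ A → T ∣ Δ′ ⊢ a ≐ 0̇
      A⇒a i = ⊃E (∧E₁ (weaken i p))
      a⇒A : ∀ {Δ′} → Δ ⊆ Δ′ → T ∣ Δ′ ⊢ a ≐ 0̇ → T ∣ Δ′ ⊢ A
      a⇒A i = ⊃E (∧E₂ (weaken i p))
      B⇒b : ∀ {Δ′} → Δ ⊆ Δ′ → T ∣ Δ′ ⊢ B → T ∣ Δ′ ⊢ b ≐ 0̇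
      B⇒b i = ⊃E (∧E₁ (weaken i q))
      b⇒B : ∀ {Δ′} → Δ ⊆ Δ′ → T ∣ Δ′ ⊢ b ≐ 0̇ → T ∣ Δ′ ⊢ B
      b⇒B i = ⊃E (∧E₂ (weaken i q))
      i₂ : ∀ {C D} → Δ ⊆ C ∷ D ∷ Δ
      i₂ x = there (there x)

    by-∧ : Γ ∣ Δ ⊨ A ∧ B by ifZero a b 1̇
    by-∧ = ∧I
      (⊃I (ifZero-zero b 1̇ (A⇒a there (∧E₁ (hyp h0))) ⟫ B⇒b there (∧E₂ (hyp h0))))
      (⊃I (byCases (a ≐ 0̇)
        (∧I (a⇒A i₂ (hyp h0)) (b⇒B i₂ (flip (ifZero-zero b 1̇ (hyp h0)) ⟫ hyp h1)))
        (exFalso (⊃E 1≢0 (flip (ifZero-nonzero b 1̇ (hyp h0)) ⟫ hyp h1)))))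

    by-∨ : Γ ∣ Δ ⊨ A ∨ B by ifZero a 0̇ b
    by-∨ = ∧I
      (⊃I (byCases (a ≐ 0̇)
        (ifZero-zero 0̇ b (hyp h0))
        (ifZero-nonzero 0̇ b (hyp h0) ⟫ ∨E (hyp h1)
          (exFalso (⊃E (hyp h1) (A⇒a (there ∘ i₂) (hyp h0))))
          (B⇒b (there ∘ i₂) (hyp h0)))))
      (⊃I (byCases (a ≐ 0̇)
        (∨I₁ (a⇒A i₂ (hyp h0)))
        (∨I₂ (b⇒B i₂ (flip (ifZero-nonzero 0̇ b (hyp h0)) ⟫ hyp h1)))))

    by-⊃ : Γ ∣ Δ ⊨ A ⊃ B by ifZero a b 0̇
    by-⊃ = ∧I
      (⊃I (byCases (a ≐ 0̇)
        (ifZero-zero b 0̇ (hyp h0) ⟫ B⇒b i₂ (⊃E (hyp h1) (a⇒A i₂ (hyp h0))))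
        (ifZero-nonzero b 0̇ (hyp h0))))
      (⊃I (⊃I (b⇒B i₂ (flip (ifZero-zero b 0̇ (A⇒a i₂ (hyp h0))) ⟫ hyp h1))))

  by-≐ : (e : 𝟐 ∈ Γ) → Decides= e ∈ Δ → (s t : Term Sg Γ o) → Γ ∣ Δ ⊨ s ≐ t by decide= e s t
  by-≐ e h s t = ∧I
    (⊃I (⊃E (∧E₂ spec) (at0 ⟫ hyp h0 ⟫ flip at1)))
    (⊃I (flip at0 ⟫ ⊃E (∧E₁ spec) (hyp h0) ⟫ at1))
    where
    body = ifZero v0 (↑ᵗ s) (↑ᵗ t)
    spec : ∀ {A} → T ∣ A ∷ _ ⊢ _
    spec = ∀E (hyp (there h)) (lam body)
    reduce : ∀ {Δ} (n : Term Sg _ o) → T ∣ Δ ⊢ lam body · n ≐ ifZero n s t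
    reduce n = subst₂ (λ a b → T ∣ _ ⊢ lam body · n ≐ ifZero n a b)
      (single-↑ᵗ n s) (single-↑ᵗ n t) (β₁ body n)
    at0 : ∀ {Δ} → T ∣ Δ ⊢ lam body · 0̇ ≐ s
    at0 = reduce 0̇ ⟫ ifZero-zero s t ≐I
    at1 : ∀ {Δ} → T ∣ Δ ⊢ lam body · 1̇ ≐ t
    at1 = reduce 1̇ ⟫ ifZero-suc s t 0̇

  find : (m : 𝟐 ∈ Γ) → FindsZero m ∈ Δ → (g : Term Sg Γ 𝟏) {n : Term Sg Γ o} →
         T ∣ Δ ⊢ g · n ≐ 0̇ → T ∣ Δ ⊢ g · (var m · g) ≐ 0̇
  find m h g {n} = ⊃E (subst (λ a → T ∣ _ ⊢ g · a ≐ 0̇ ⊃ g · (var m · g) ≐ 0̇)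
    (single-↑ᵗ g n) (∀E (∀E (hyp h) n) g))

  module _ (m : 𝟐 ∈ Γ) {Δ : List (Formula Sg Γ)} (h : FindsZero m ∈ Δ)
           {A : Formula Sg (o ∷ Γ)} {t : Term Sg (o ∷ Γ) o}
           (p : o ∷ Γ ∣ map ↑ Δ ⊨ A by t) where

    by-single : (n : Term Sg Γ o) → Γ ∣ Δ ⊨ A [ n ] by subᵗ (single n) t
    by-single n = ∀E (∀I p) n

    -- If some number satisfies `A`, then the function `lam t` has a zero there, and the search
    -- returns a zero.
    witness-∃ : T ∣ Δ ⊢ ∃̇ o A ⊃ A [ witness m t ]
    witness-∃ = ⊃I (⊃E (∧E₂ (wk (by-single _))) (flip (β₁ t _) ⟫ found))
      where
      found : T ∣ ∃̇ o A ∷ Δ ⊢ lam t · (var m · lam t) ≐ 0̇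
      found = ∃E (hyp h0) (find (there m) (there (there (∈-map⁺ ↑ h))) (↑ᵗ (lam t))
        (lam-v0 t ⟫ ⊃E (∧E₁ (weaken (there ∘ there) p)) (hyp h0)))

  -- Classically a failing universal statement has a counterexample, and the search would then
  -- return one. So if `A` holds at the number returned, there is none.
  counterexample-∀ : (m : 𝟐 ∈ Γ) {Δ : List (Formula Sg Γ)} (h : FindsZero m ∈ Δ)
    {A : Formula Sg (o ∷ Γ)} {t : Term Sg (o ∷ Γ) o} (p : o ∷ Γ ∣ map ↑ Δ ⊨ A by t) →
    T ∣ Δ ⊢ A [ witness m (not t) ] ⊃ ∀̇ o A
  counterexample-∀ m h {A} {t} p = ⊃I (byCases (∃̇ o (¬̇ A))
    -- `not t` is definitionally the truth value that `by-⊃` and `by-⊥` assign to the negation of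
    -- `A`.
    (exFalso (⊃E (⊃E (weaken (there ∘ there) (witness-∃ m h (by-⊃ p by-⊥))) (hyp h0)) (hyp h1)))
    (∀I (raa (⊃E (hyp h1) (∃-v0 (hyp h0))))))

  -- By induction on `A`: each quantifier is first replaced by the instance at the number searched
  -- for, which the induction hypothesis then evaluates.
  by-χ : (A : Formula Sg Γ) (a : Arithmetical A) (e m : 𝟐 ∈ Γ) {Δ : List (Formula Sg Γ)} →
         Decides= e ∈ Δ → FindsZero m ∈ Δ → Γ ∣ Δ ⊨ A by χ A a e m
  by-χ (s ≐ t) _ e m he hm       = by-≐ e he s t
  by-χ ⊥̇ _ e m he hm             = by-⊥
  by-χ (A ∧ B) (a , b) e m he hm = by-∧ (by-χ A a e m he hm) (by-χ B b e m he hm)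
  by-χ (A ∨ B) (a , b) e m he hm = by-∨ (by-χ A a e m he hm) (by-χ B b e m he hm)
  by-χ (A ⊃ B) (a , b) e m he hm = by-⊃ (by-χ A a e m he hm) (by-χ B b e m he hm)
  by-χ (∀̇ o A) a e m he hm       = ⇔-trans
    (∧I (⊃I (∀E (hyp h0) _)) (counterexample-∀ m hm p)) (by-single m hm p _)
    where p = by-χ A a (there e) (there m) (∈-map⁺ ↑ he) (∈-map⁺ ↑ hm)
  by-χ (∃̇ o A) a e m he hm       = ⇔-trans
    (∧I (witness-∃ m hm p) (⊃I (∃I _ (hyp h0)))) (by-single m hm p _)
    where p = by-χ A a (there e) (there m) (∈-map⁺ ↑ he) (∈-map⁺ ↑ hm)

-- Standardness

sub-ˢᵗ : (s : Subst Sg Γ Θ) (A : Formula Sg Γ) → sub s (A ˢᵗ) ≡ (sub s A) ˢᵗ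
sub-ˢᵗ s (t ≐ u) = refl
sub-ˢᵗ s (st t)  = refl
sub-ˢᵗ s ⊥̇       = refl
sub-ˢᵗ s (A ∧ B) = cong₂ _∧_ (sub-ˢᵗ s A) (sub-ˢᵗ s B)
sub-ˢᵗ s (A ∨ B) = cong₂ _∨_ (sub-ˢᵗ s A) (sub-ˢᵗ s B)
sub-ˢᵗ s (A ⊃ B) = cong₂ _⊃_ (sub-ˢᵗ s A) (sub-ˢᵗ s B)
sub-ˢᵗ s (∀̇ σ A) = cong (λ B → ∀̇ σ (st v0 ⊃ B)) (sub-ˢᵗ (liftˢ s) A)
sub-ˢᵗ s (∃̇ σ A) = cong (λ B → ∃̇ σ (st v0 ∧ B)) (sub-ˢᵗ (liftˢ s) A)

module Nonstandard (F : Functionals) (T : Theory (signature F))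
                   (Ω : ∀ {Γ A} → RCA₀Ω F Γ A → T Γ A) where

  open Derivability T (λ a → Ω (rca₀ω a)) public

  private variable
    Δ : List (Formula (signature F) Γ)

  -- `PF-TP∀` for the negation of `A`; the renaming along `lift λ ()` places a parameter-free
  -- formula in an arbitrary context.
  ∃ˢᵗ-transfer : (A : Formula (signature F) (τ ∷ [])) → Internal A →
                 T ∣ Δ ⊢ ∃̇ {Γ = Γ} τ (ren (lift λ ()) A) ⊃ ∃ˢᵗ τ (ren (lift λ ()) A)
  ∃ˢᵗ-transfer A i = ⊃I (raa (cut
    (⊃E (axiom (Ω (PF-TP∀ (¬̇ A) (i , _))))
      (∀I (⊃I (⊃I (⊃E (hyp h2) (∃-v0 (∧I (hyp h1) (hyp h0))))))))
    (∃E (hyp h2) (⊃E (wk (∀-hyp h0)) (hyp h0)))))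

  st-term : (∀ {σ} (x : σ ∈ Γ) → T ∣ Δ ⊢ st (var x)) → (t : Term (signature F) Γ σ) → T ∣ Δ ⊢ st t
  st-term h (var x) = h x
  st-term h (con c) = axiom (Ω (st-closed (con c)))
  st-term h (t · u) = ⊃E (⊃E (axiom (Ω (st-app t u))) (st-term h t)) (st-term h u)

  -- QF-AC¹⁰, where 0 or 1 is chosen by cases on whether the two values of the function agree.
  ∃-Decides= : T ∣ Δ ⊢ ∃̇ {Γ = Γ} 𝟐 (Decides= h0)
  ∃-Decides= = ⊃E (axiom (Ω (rca₀ω (qf-ac¹⁰ (qf-ac (v0 ≐ 0̇ ⇔ v1 · 0̇ ≐ v1 · 1̇) _)))))
    (∀I (byCases (v0 · 0̇ ≐ v0 · 1̇)
      (∃I 0̇ (∧I (⊃I (hyp h1)) (⊃I ≐I)))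
      (∃I 1̇ (∧I (⊃I (exFalso (⊃E 1≢0 (hyp h0)))) (⊃I (exFalso (⊃E (hyp h1) (hyp h0))))))))

  -- With the functional φ of (∃²) as a parameter, the implication from φ(g) = 0 to g(y) = 0 is
  -- quantifier-free, and each g has some y satisfying it. QF-AC¹⁰ collects these y.
  ∃-FindsZero : T ∣ Δ ⊢ closed {Γ = Γ} ∃² → T ∣ Δ ⊢ ∃̇ {Γ = Γ} 𝟐 (FindsZero h0)
  ∃-FindsZero p = ∃E p (∃E
    (⊃E (axiom (Ω (rca₀ω (qf-ac¹⁰ (qf-ac (v2 · v1 ≐ 0̇ ⊃ v1 · v0 ≐ 0̇) _)))))
      (∀I (byCases (v1 · v0 ≐ 0̇)
        (∃E (⊃E (∧E₂ (∀E (hyp h1) v0)) (hyp h0)) (∃I v0 (⊃I (hyp h1))))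
        (∃I 0̇ (⊃I (exFalso (⊃E (hyp h1) (hyp h0))))))))
    (∃I v0 (∀I (∀I (⊃I (⊃E (∀E (hyp h1) v0) (⊃E (∧E₁ (∀E (hyp h2) v0)) (∃I v1 (hyp h0)))))))))

  Standard : (Γ : Ctx) → List (Formula (signature F) Γ) → Set
  Standard Γ Δ = ∀ {σ} (x : σ ∈ Γ) → st (var x) ∈ Δ

  Standard-∷ : Standard Γ Δ → Standard (σ ∷ Γ) (st v0 ∷ map ↑ Δ)
  Standard-∷ h (here refl) = here refl
  Standard-∷ h (there x)   = there (∈-map⁺ ↑ (h x))

  -- Quantifying over standard numbers loses nothing: the witness or counterexample found by `m` is
  -- a term in standard variables, hence a standard number.
  absolute : (A : Formula (signature F) Γ) → Arithmetical A → (e m : 𝟐 ∈ Γ) →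
             Decides= e ∈ Δ → FindsZero m ∈ Δ → Standard Γ Δ → T ∣ Δ ⊢ A ˢᵗ ⇔ A
  absolute (s ≐ t) a e m he hm h = ∧I (⊃I (hyp h0)) (⊃I (hyp h0))
  absolute ⊥̇ a e m he hm h = ∧I (⊃I (hyp h0)) (⊃I (hyp h0))
  absolute (A ∧ B) (a , b) e m he hm h = ∧I
    (⊃I (∧I (⊃E (∧E₁ (wk p)) (∧E₁ (hyp h0))) (⊃E (∧E₁ (wk q)) (∧E₂ (hyp h0)))))
    (⊃I (∧I (⊃E (∧E₂ (wk p)) (∧E₁ (hyp h0))) (⊃E (∧E₂ (wk q)) (∧E₂ (hyp h0)))))
    where
    p = absolute A a e m he hm h
    q = absolute B b e m he hm h
  absolute (A ∨ B) (a , b) e m he hm h = ∧I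
    (⊃I (∨E (hyp h0) (∨I₁ (⊃E (∧E₁ (wk (wk p))) (hyp h0))) (∨I₂ (⊃E (∧E₁ (wk (wk q))) (hyp h0)))))
    (⊃I (∨E (hyp h0) (∨I₁ (⊃E (∧E₂ (wk (wk p))) (hyp h0))) (∨I₂ (⊃E (∧E₂ (wk (wk q))) (hyp h0)))))
    where
    p = absolute A a e m he hm h
    q = absolute B b e m he hm h
  absolute (A ⊃ B) (a , b) e m he hm h = ∧I
    (⊃I (⊃I (⊃E (∧E₁ (wk (wk q))) (⊃E (hyp h1) (⊃E (∧E₂ (wk (wk p))) (hyp h0))))))
    (⊃I (⊃I (⊃E (∧E₂ (wk (wk q))) (⊃E (hyp h1) (⊃E (∧E₁ (wk (wk p))) (hyp h0))))))
    where
    p = absolute A a e m he hm h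
    q = absolute B b e m he hm h
  absolute (∀̇ o A) a e m he hm h = ∧I
    -- The candidate counterexample `w` is standard, so the relativised hypothesis covers it, and
    -- truth at `w` implies truth everywhere.
    (⊃I (⊃E (wk (counterexample-∀ m hm (by-χ A a (there e) (there m) (∈-map⁺ ↑ he) (∈-map⁺ ↑ hm))))
      (⊃E (∧E₁ (⊃E (wk (∀E abs-A w)) st-w)) (⊃E (∀E (hyp h0) w) st-w))))
    (⊃I (∀I (⊃I (⊃E (∧E₂ (weaken (∷⁺ʳ _ there) p)) (wk (∀-hyp h0))))))
    where
    p = absolute A a (there e) (there m) (there (∈-map⁺ ↑ he)) (there (∈-map⁺ ↑ hm)) (Standard-∷ h)
    abs-A = ∀I (⊃I p)
    w = witness m (not (χ A a (there e) (there m)))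
    st-w : ∀ {B} → T ∣ B ∷ _ ⊢ st w
    st-w = st-term (λ x → hyp (there (h x))) w
  absolute (∃̇ o A) a e m he hm h = ∧I
    (⊃I (∃E (hyp h0) (∃-v0 (⊃E (∧E₁ (⊃E
      (weaken (there ∘ there) (⊃I p)) (∧E₁ (hyp h0)))) (∧E₂ (hyp h0))))))
    -- A given witness may be nonstandard; the one found by the search replaces it.
    (⊃I (∃I w (∧I st-w (⊃E (∧E₂ (⊃E (wk (∀E abs-A w)) st-w))
      (⊃E (wk (witness-∃ m hm (by-χ A a (there e) (there m) (∈-map⁺ ↑ he) (∈-map⁺ ↑ hm))))
        (hyp h0))))))
    where
    p = absolute A a (there e) (there m) (there (∈-map⁺ ↑ he)) (there (∈-map⁺ ↑ hm)) (Standard-∷ h)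
    abs-A = ∀I (⊃I p)
    w = witness m (χ A a (there e) (there m))
    st-w : ∀ {B} → T ∣ B ∷ _ ⊢ st w
    st-w = st-term (λ x → hyp (there (h x))) w

-- Schemata

triple : Ctx
triple = 𝟏 ∷ 𝟏 ∷ 𝟏 ∷ []

infixr 18 _∧′_
infixr 16 _⊃′_
infix  15 _⇔′_

-- Formulas with atoms `at A ts`, standing for A(ts).  Substitution acts on the
-- arguments only, and so computes for a variable A.
data Schema (Sg : Signature) (Γ : Ctx) : Set where
  ⌜_⌝       : Formula Sg Γ → Schema Sg Γ
  at        : Formula Sg Ξ → All (Term Sg Γ) Ξ → Schema Sg Γ
  _∧′_ _⊃′_ : Schema Sg Γ → Schema Sg Γ → Schema Sg Γ
  ∀′ ∃′     : (σ : Ty) → Schema Sg (σ ∷ Γ) → Schema Sg Γ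

⌊_⌋ : Schema Sg Γ → Formula Sg Γ
⌊ ⌜ A ⌝ ⌋      = A
⌊ at A ts ⌋    = sub (lookup ts) A
⌊ A ∧′ B ⌋     = ⌊ A ⌋ ∧ ⌊ B ⌋
⌊ A ⊃′ B ⌋     = ⌊ A ⌋ ⊃ ⌊ B ⌋
⌊ ∀′ σ A ⌋     = ∀̇ σ ⌊ A ⌋
⌊ ∃′ σ A ⌋     = ∃̇ σ ⌊ A ⌋

ren′ : Γ ⊆ Θ → Schema Sg Γ → Schema Sg Θ
ren′ r ⌜ A ⌝        = ⌜ ren r A ⌝
ren′ r (at A ts)    = at A (All.map (renᵗ r) ts)
ren′ r (A ∧′ B)     = ren′ r A ∧′ ren′ r B
ren′ r (A ⊃′ B)     = ren′ r A ⊃′ ren′ r B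
ren′ r (∀′ σ A)     = ∀′ σ (ren′ (lift r) A)
ren′ r (∃′ σ A)     = ∃′ σ (ren′ (lift r) A)

sub′ : Subst Sg Γ Θ → Schema Sg Γ → Schema Sg Θ
sub′ s ⌜ A ⌝        = ⌜ sub s A ⌝
sub′ s (at A ts)    = at A (All.map (subᵗ s) ts)
sub′ s (A ∧′ B)     = sub′ s A ∧′ sub′ s B
sub′ s (A ⊃′ B)     = sub′ s A ⊃′ sub′ s B
sub′ s (∀′ σ A)     = ∀′ σ (sub′ (liftˢ s) A)
sub′ s (∃′ σ A)     = ∃′ σ (sub′ (liftˢ s) A)

↑′ : Schema Sg Γ → Schema Sg (σ ∷ Γ)
↑′ = ren′ there

args : (f X Y : Term Sg Γ 𝟏) → All (Term Sg Γ) triple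
args f X Y = Y ∷ X ∷ f ∷ []

at₃ : Formula Sg triple → (f X Y : Term Sg Γ 𝟏) → Schema Sg Γ
at₃ A f X Y = at A (args f X Y)

⌊ren′⌋ : (r : Γ ⊆ Θ) (A : Schema Sg Γ) → ⌊ ren′ r A ⌋ ≡ ren r ⌊ A ⌋
⌊ren′⌋ r ⌜ A ⌝        = refl
⌊ren′⌋ r (at A ts)    = sym (trans (ren-sub r (lookup ts) A)
  (sub-cong (λ x → sym (lookup-map ts x)) A))
⌊ren′⌋ r (A ∧′ B)     = cong₂ _∧_ (⌊ren′⌋ r A) (⌊ren′⌋ r B)
⌊ren′⌋ r (A ⊃′ B)     = cong₂ _⊃_ (⌊ren′⌋ r A) (⌊ren′⌋ r B)
⌊ren′⌋ r (∀′ σ A)     = cong (∀̇ σ) (⌊ren′⌋ (lift r) A)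
⌊ren′⌋ r (∃′ σ A)     = cong (∃̇ σ) (⌊ren′⌋ (lift r) A)

⌊sub′⌋ : (s : Subst Sg Γ Θ) (A : Schema Sg Γ) → ⌊ sub′ s A ⌋ ≡ sub s ⌊ A ⌋
⌊sub′⌋ s ⌜ A ⌝        = refl
⌊sub′⌋ s (at A ts)    = sym (trans (sub-∘ s (lookup ts) A)
  (sub-cong (λ x → sym (lookup-map ts x)) A))
⌊sub′⌋ s (A ∧′ B)     = cong₂ _∧_ (⌊sub′⌋ s A) (⌊sub′⌋ s B)
⌊sub′⌋ s (A ⊃′ B)     = cong₂ _⊃_ (⌊sub′⌋ s A) (⌊sub′⌋ s B)
⌊sub′⌋ s (∀′ σ A)     = cong (∀̇ σ) (⌊sub′⌋ (liftˢ s) A)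
⌊sub′⌋ s (∃′ σ A)     = cong (∃̇ σ) (⌊sub′⌋ (liftˢ s) A)

map-↑′ : (Δ : List (Schema Sg Γ)) → map ⌊_⌋ (map (↑′ {σ = σ}) Δ) ≡ map ↑ (map ⌊_⌋ Δ)
map-↑′ []      = refl
map-↑′ (A ∷ Δ) = cong₂ _∷_ (⌊ren′⌋ there A) (map-↑′ Δ)

_⇔′_ : Schema Sg Γ → Schema Sg Γ → Schema Sg Γ
A ⇔′ B = (A ⊃′ B) ∧′ (B ⊃′ A)

Fn : Ty
Fn = 𝟏 ⇒ 𝟏 ⇒ 𝟏 ⇒ o

vanishes : Term Sg Γ Fn → (f X Y : Term Sg Γ 𝟏) → Schema Sg Γ
vanishes g f X Y = at (v3 · v2 · v1 · v0 ≐ 0̇) (Y ∷ X ∷ f ∷ g ∷ [])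

infix 20 _≈_ _∈′_

_≈_ : Term Sg Γ 𝟏 → Term Sg Γ 𝟏 → Schema Sg Γ
s ≈ t = at (Eq 𝟏 v1 v0) (t ∷ s ∷ [])

_∈′_ : Term Sg Γ 𝟏 → Term Sg Γ (𝟏 *) → Schema Sg Γ
y ∈′ s = at (v0 ∈̇ v1) (y ∷ s ∷ [])

-- The two are used for the same `x`: it is a characteristic function of `A`, with 0 for truth, and
-- at standard arguments also one of the relativised `A`. Together they carry the absoluteness of
-- `A`.
Char Charˢᵗ : Formula Sg triple → Fn ∈ Γ → Schema Sg Γ
Char A x = ∀′ 𝟏 (∀′ 𝟏 (∀′ 𝟏
  (at₃ A v2 v1 v0 ⇔′ vanishes (var (there (there (there x)))) v2 v1 v0)))
Charˢᵗ A x = ∀′ 𝟏 (⌜ st v0 ⌝ ⊃′ ∀′ 𝟏 (⌜ st v0 ⌝ ⊃′ ∀′ 𝟏 (⌜ st v0 ⌝ ⊃′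
  (at₃ (A ˢᵗ) v2 v1 v0 ⇔′ vanishes (var (there (there (there x)))) v2 v1 v0))))

arithmetical-sub : (s : Subst Sg Γ Θ) (A : Formula Sg Γ) → Arithmetical A → Arithmetical (sub s A)
arithmetical-sub s (t ≐ u) a       = _
arithmetical-sub s ⊥̇ a             = _
arithmetical-sub s (A ∧ B) (a , b) = arithmetical-sub s A a , arithmetical-sub s B b
arithmetical-sub s (A ∨ B) (a , b) = arithmetical-sub s A a , arithmetical-sub s B b
arithmetical-sub s (A ⊃ B) (a , b) = arithmetical-sub s A a , arithmetical-sub s B b
arithmetical-sub s (∀̇ o A) a       = arithmetical-sub (liftˢ s) A a
arithmetical-sub s (∃̇ o A) a       = arithmetical-sub (liftˢ s) A a

arithmetical-internal : (A : Formula Sg Γ) → Arithmetical A → Internal A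
arithmetical-internal (t ≐ u) a       = _
arithmetical-internal ⊥̇ a             = _
arithmetical-internal (A ∧ B) (a , b) = arithmetical-internal A a , arithmetical-internal B b
arithmetical-internal (A ∨ B) (a , b) = arithmetical-internal A a , arithmetical-internal B b
arithmetical-internal (A ⊃ B) (a , b) = arithmetical-internal A a , arithmetical-internal B b
arithmetical-internal (∀̇ o A) a       = arithmetical-internal A a
arithmetical-internal (∃̇ o A) a       = arithmetical-internal A a

module Schemata (F : Functionals) (T : Theory (signature F))
                (Ω : ∀ {Γ A} → RCA₀Ω F Γ A → T Γ A) where

  open Nonstandard F T Ω public

  Sch : Ctx → Set
  Sch = Schema (signature F)

  Tm : Ctx → Ty → Set
  Tm = Term (signature F)

  private variable
    Δ Δ′ : List (Sch Γ)
    A B C : Sch Γ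

  infix 4 _⊩_

  -- A record keeps the schema visible to unification: `⌊_⌋` is not injective, so `A` could not be
  -- inferred from its unfolding.
  record _⊩_ {Γ : Ctx} (Δ : List (Sch Γ)) (A : Sch Γ) : Set where
    constructor ⊩I
    field ⊩E : T ∣ map ⌊_⌋ Δ ⊢ ⌊ A ⌋

  open _⊩_ public

  hyp′ : A ∈ Δ → Δ ⊩ A
  hyp′ h = ⊩I (hyp (∈-map⁺ ⌊_⌋ h))

  ⊃I′ : A ∷ Δ ⊩ B → Δ ⊩ A ⊃′ B
  ⊃I′ (⊩I p) = ⊩I (⊃I p)

  ⊃E′ : Δ ⊩ A ⊃′ B → Δ ⊩ A → Δ ⊩ B
  ⊃E′ (⊩I p) (⊩I q) = ⊩I (⊃E p q)

  ∧I′ : Δ ⊩ A → Δ ⊩ B → Δ ⊩ A ∧′ B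
  ∧I′ (⊩I p) (⊩I q) = ⊩I (∧I p q)

  ∧E₁′ : Δ ⊩ A ∧′ B → Δ ⊩ A
  ∧E₁′ (⊩I p) = ⊩I (∧E₁ p)

  ∧E₂′ : Δ ⊩ A ∧′ B → Δ ⊩ B
  ∧E₂′ (⊩I p) = ⊩I (∧E₂ p)

  exFalso′ : Δ ⊩ ⌜ ⊥̇ ⌝ → Δ ⊩ A
  exFalso′ (⊩I p) = ⊩I (exFalso p)

  byCases′ : (A : Sch Γ) → A ∷ Δ ⊩ B → (A ⊃′ ⌜ ⊥̇ ⌝) ∷ Δ ⊩ B → Δ ⊩ B
  byCases′ A (⊩I p) (⊩I q) = ⊩I (byCases ⌊ A ⌋ p q)

  weaken′ : Δ ⊆ Δ′ → Δ ⊩ A → Δ′ ⊩ A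
  weaken′ i (⊩I p) = ⊩I (weaken (map⁺ ⌊_⌋ i) p)

  ∀I′ : {A : Sch (σ ∷ Γ)} → map ↑′ Δ ⊩ A → Δ ⊩ ∀′ σ A
  ∀I′ {Δ = Δ} (⊩I p) = ⊩I (∀I (subst (λ Δ → T ∣ Δ ⊢ _) (map-↑′ Δ) p))

  ∀E′ : {A : Sch (σ ∷ Γ)} → Δ ⊩ ∀′ σ A → (t : Tm Γ σ) →
        Δ ⊩ sub′ (single t) A
  ∀E′ {A = A} (⊩I p) t = ⊩I (subst (T ∣ _ ⊢_) (sym (⌊sub′⌋ (single t) A)) (∀E p t))

  ∃I′ : {A : Sch (σ ∷ Γ)} (t : Tm Γ σ) →
        Δ ⊩ sub′ (single t) A → Δ ⊩ ∃′ σ A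
  ∃I′ {A = A} t (⊩I p) = ⊩I (∃I t (subst (T ∣ _ ⊢_) (⌊sub′⌋ (single t) A) p))

  ∃E′ : {A : Sch (σ ∷ Γ)} →
        Δ ⊩ ∃′ σ A → A ∷ map ↑′ Δ ⊩ ↑′ C → Δ ⊩ C
  ∃E′ {Δ = Δ} {C = C} (⊩I p) (⊩I q) = ⊩I (∃E p
    (subst₂ (λ Δ C → T ∣ _ ∷ Δ ⊢ C) (map-↑′ Δ) (⌊ren′⌋ there C) q))

  private
    curried : (t : Tm (𝟏 ∷ 𝟏 ∷ 𝟏 ∷ Γ) o) {Δ : List (Formula (signature F) _)} →
              T ∣ Δ ⊢ ↑ᵗ (↑ᵗ (↑ᵗ (lam (lam (lam t))))) · v2 · v1 · v0 ≐ t
    curried {Γ} t = subst₂ (λ a b → T ∣ _ ⊢ a · v2 · v1 · v0 ≐ b) eq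
      (trans
        (subᵗ-cong (λ { h0 → refl ; h1 → refl ; h2 → refl ; (there (there (there x))) → refl }) t)
        (subᵗ-var t))
      (Eq-appˡ (β₂ q (lam t) v2 v1) v0 ⟫ β (q ▹ v2 ▹ v1) t v0)
      where
      q : Subst (signature F) Γ (𝟏 ∷ 𝟏 ∷ 𝟏 ∷ Γ)
      q x = var (there (there (there x)))
      eq : subᵗ q (lam (lam (lam t))) ≡ ↑ᵗ (↑ᵗ (↑ᵗ (lam (lam (lam t)))))
      eq = sym (trans (renᵗ-∘ there there (↑ᵗ (lam (lam (lam t)))))
        (trans (renᵗ-∘ (λ x → there (there x)) there (lam (lam (lam t))))
          (renᵗ-as-subᵗ (λ x → there (there (there x))) (lam (lam (lam t))))))

  by-cong : {A : Formula (signature F) Γ} {Δ : List (Formula (signature F) Γ)} {a b : Tm Γ o} →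
            T ∣ Δ ⊢ a ≐ b → Γ ∣ Δ ⊨ A by b → Γ ∣ Δ ⊨ A by a
  by-cong p q = ∧I (⊃I (wk p ⟫ ⊃E (∧E₁ (wk q)) (hyp h0)))
    (⊃I (⊃E (∧E₂ (wk q)) (flip (wk p) ⟫ hyp h0)))

  private
    lift₃ : B ∈ Δ → ⌊ ↑′ {σ = ρ} (↑′ {σ = σ} (↑′ {σ = τ} B)) ⌋ ∈
            map ⌊_⌋ (map ↑′ (map ↑′ (map ↑′ Δ)))
    lift₃ x = ∈-map⁺ ⌊_⌋ (∈-map⁺ ↑′ (∈-map⁺ ↑′ (∈-map⁺ ↑′ x)))

    lift₃ˢᵗ : B ∈ Δ → ⌊ ↑′ {σ = ρ} (↑′ {σ = σ} (↑′ {σ = τ} B)) ⌋ ∈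
              map ⌊_⌋ (⌜ st v0 ⌝ ∷ map ↑′ (⌜ st v0 ⌝ ∷ map ↑′ (⌜ st v0 ⌝ ∷ map ↑′ Δ)))
    lift₃ˢᵗ x = ∈-map⁺ ⌊_⌋
      (there {x = ⌜ st v0 ⌝} (∈-map⁺ ↑′ (there {x = ⌜ st v0 ⌝} (∈-map⁺ ↑′
        (there {x = ⌜ st v0 ⌝} (∈-map⁺ ↑′ x))))))

  AllStandard : List (Sch Γ) → Set
  AllStandard {Γ} Δ = ∀ {σ} (x : σ ∈ Γ) → ⌜ st (var x) ⌝ ∈ Δ

  -- The abstraction of `χ` is standard because all variables are. `by-χ` evaluates `A` itself; at
  -- standard arguments `absolute` first passes from the relativised `A` to `A`.
  ∃-Char : (A : Formula (signature F) triple) → Arithmetical A → (e m : 𝟐 ∈ Γ) →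
           ⌜ Decides= e ⌝ ∈ Δ → ⌜ FindsZero m ⌝ ∈ Δ →
           AllStandard Δ →
           Δ ⊩ ∃′ Fn (⌜ st v0 ⌝ ∧′ Char A h0 ∧′ Charˢᵗ A h0)
  ∃-Char A a e m he hm h = ∃I′ (lam (lam (lam t)))
    (∧I′ (⊩I (st-term (λ x → hyp (∈-map⁺ ⌊_⌋ (h x))) (lam (lam (lam t)))))
    (∧I′
      (∀I′ (∀I′ (∀I′ (⊩I (by-cong (curried t)
        (by-χ A′ a′ _ _ (lift₃ he) (lift₃ hm)))))))
      (∀I′ (⊃I′ (∀I′ (⊃I′ (∀I′ (⊃I′ (⊩I (by-cong (curried t)
        (subst (λ B → T ∣ _ ⊢ B ⇔ t ≐ 0̇) (sym (sub-ˢᵗ (lookup (args v2 v1 v0)) A))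
          (⇔-trans
            (absolute A′ a′ _ _ (lift₃ˢᵗ he) (lift₃ˢᵗ hm) standard)
            (by-χ A′ a′ _ _ (lift₃ˢᵗ he) (lift₃ˢᵗ hm))))))))))))))
    where
    A′ = sub (lookup (args v2 v1 v0)) A
    a′ = arithmetical-sub (lookup (args v2 v1 v0)) A a
    t = χ A′ a′ (there (there (there e))) (there (there (there m)))
    standard : Standard _ _
    standard h0 = here refl
    standard h1 = there (here refl)
    standard h2 = there (there (here refl))
    standard (there (there (there x))) = lift₃ˢᵗ (h x)

  ∀ˢᵗ′ ∃ˢᵗ′ : (σ : Ty) → Sch (σ ∷ Γ) → Sch Γ
  ∀ˢᵗ′ σ A = ∀′ σ (⌜ st v0 ⌝ ⊃′ A)
  ∃ˢᵗ′ σ A = ∃′ σ (⌜ st v0 ⌝ ∧′ A)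

  consˢᵗ : AllStandard Δ → AllStandard (⌜ st (v0 {σ = σ}) ⌝ ∷ map ↑′ Δ)
  consˢᵗ h (here refl) = h0
  consˢᵗ h (there x)   = there (∈-map⁺ ↑′ (h x))

  st′ : AllStandard Δ → (t : Tm Γ σ) → Δ ⊩ ⌜ st t ⌝
  st′ h t = ⊩I (st-term (λ x → hyp (∈-map⁺ ⌊_⌋ (h x))) t)

  infixl 20 _⊛_

  _⊛_ : {f : Tm Γ (σ ⇒ τ)} {t : Tm Γ σ} →
        Δ ⊩ ⌜ st f ⌝ → Δ ⊩ ⌜ st t ⌝ → Δ ⊩ ⌜ st (f · t) ⌝
  p ⊛ q = ⊃E′ (⊃E′ (⊩I (axiom (Ω (st-app _ _)))) p) q

  ∃ˢᵗE : {A : Sch (σ ∷ Γ)} → Δ ⊩ ∃ˢᵗ′ σ A → A ∷ ⌜ st v0 ⌝ ∷ map ↑′ Δ ⊩ ↑′ C → Δ ⊩ C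
  ∃ˢᵗE p q = ∃E′ p (⊃E′ (⊃E′ (weaken′ there (⊃I′ (⊃I′ q))) (∧E₁′ (hyp′ h0))) (∧E₂′ (hyp′ h0)))

  cut′ : Δ ⊩ A → A ∷ Δ ⊩ B → Δ ⊩ B
  cut′ p q = ⊃E′ (⊃I′ q) p

  infixr 5 _⨾_

  _⨾_ : Δ ⊩ A ⊃′ B → Δ ⊩ B ⊃′ C → Δ ⊩ A ⊃′ C
  ⊩I p ⨾ ⊩I q = ⊩I (⊃-trans p q)

  ∀-transfer′ : (A : Sch (τ ∷ [])) → Internal ⌊ A ⌋ →
                Δ ⊩ ∀ˢᵗ′ {Γ = Γ} τ (ren′ (lift λ ()) A) → Δ ⊩ ∀′ τ (ren′ (lift λ ()) A)
  ∀-transfer′ {τ = τ} A i (⊩I p) = ⊩I (subst (λ B → T ∣ _ ⊢ ∀̇ τ B) (sym (⌊ren′⌋ (lift λ ()) A))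
    (⊃E (axiom (Ω (PF-TP∀ ⌊ A ⌋ i)))
      (subst (λ B → T ∣ _ ⊢ ∀ˢᵗ τ B) (⌊ren′⌋ (lift λ ()) A) p)))

  ∃-transfer′ : (A : Sch (τ ∷ [])) → Internal ⌊ A ⌋ →
                Δ ⊩ ∃′ {Γ = Γ} τ (ren′ (lift λ ()) A) → Δ ⊩ ∃ˢᵗ′ τ (ren′ (lift λ ()) A)
  ∃-transfer′ {τ = τ} A i (⊩I p) = ⊩I (subst (λ B → T ∣ _ ⊢ ∃ˢᵗ τ B) (sym (⌊ren′⌋ (lift λ ()) A))
    (⊃E (∃ˢᵗ-transfer ⌊ A ⌋ i)
      (subst (λ B → T ∣ _ ⊢ ∃̇ τ B) (⌊ren′⌋ (lift λ ()) A) p)))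

-- The equivalences

-- L(f , X , Y) means that X is a linear order, D(f , X , h) that h descends in X,
-- and P(f , X , Y) that H_f(X , Y).  All that matters is that they are
-- arithmetical; as variables they are never unfolded.
module Equivalences (F : Functionals) (T : Theory (signature F))
                    (Ω : ∀ {Γ A} → RCA₀Ω F Γ A → T Γ A)
                    (L D P : Formula (signature F) triple)
                    (L-arithmetical : Arithmetical L) (D-arithmetical : Arithmetical D)
                    (P-arithmetical : Arithmetical P) where

  open Schemata F T Ω public

  private variable
    Δ : List (Sch Γ)
    A B C : Sch Γ

  -- In the intended reading `L` concerns one set, and `D` a set and a sequence; `X` fills the
  -- remaining argument places, so that all three formulas have the same arity.
  WO′ WOˢᵗ : Tm Γ 𝟏 → Sch Γ
  WO′ X  = at₃ L X X X ∧′ (∃′ 𝟏 (at₃ D (↑ᵗ X) (↑ᵗ X) v0) ⊃′ ⌜ ⊥̇ ⌝)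
  WOˢᵗ X = at₃ (L ˢᵗ) X X X ∧′ (∃′ 𝟏 (⌜ st v0 ⌝ ∧′ at₃ (D ˢᵗ) (↑ᵗ X) (↑ᵗ X) v0) ⊃′ ⌜ ⊥̇ ⌝)

  ATR′ ATRˢᵗ UATR′ UATRˢᵗ ATR*′ : Sch Γ
  ATR′   = ∀′ 𝟏 (∀′ 𝟏 (WO′ v0 ⊃′ ∃′ 𝟏 (at₃ P v2 v1 v0)))
  ATRˢᵗ  = ∀ˢᵗ′ 𝟏 (∀ˢᵗ′ 𝟏 (WOˢᵗ v0 ⊃′ ∃ˢᵗ′ 𝟏 (at₃ (P ˢᵗ) v2 v1 v0)))
  UATR′  = ∃′ (𝟏 ⇒ 𝟏) (∀′ 𝟏 (∀′ 𝟏 (WO′ v0 ⊃′ at₃ P v1 v0 (v2 · ⟨ v1 , v0 ⟩))))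
  UATRˢᵗ = ∃ˢᵗ′ (𝟏 ⇒ 𝟏) (∀ˢᵗ′ 𝟏 (∀ˢᵗ′ 𝟏
             (WOˢᵗ v0 ⊃′ at₃ (P ˢᵗ) v1 v0 (v2 · ⟨ v1 , v0 ⟩))))
  ATR*′  = ∀ˢᵗ′ 𝟏 (∀ˢᵗ′ 𝟏 (WO′ v0 ⊃′ ∃ˢᵗ′ 𝟏 (at₃ (P ˢᵗ) v2 v1 v0)))

  UATR⊃ATR : Δ ⊩ UATR′ ⊃′ ATR′
  UATR⊃ATR = ⊃I′ (∃E′ (hyp′ h0) (∀I′ (∀I′ (⊃I′ (∃I′ (v2 · ⟨ v1 , v0 ⟩)
    (⊃E′ (∀E′ (∀E′ (hyp′ h1) v1) v0) (hyp′ h0)))))))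

  UATRˢᵗ⊃ATRˢᵗ : AllStandard Δ → Δ ⊩ UATRˢᵗ ⊃′ ATRˢᵗ
  UATRˢᵗ⊃ATRˢᵗ {Γ} {Δ} hs = ⊃I′ (∃ˢᵗE (hyp′ h0) (∀I′ (⊃I′ (∀I′ (⊃I′ (⊃I′
    (∃I′ (v2 · ⟨ v1 , v0 ⟩) (∧I′
      (st′ (there ∘ hs₂) (v2 · ⟨ v1 , v0 ⟩))
      (⊃E′ (⊃E′ (∀E′ (⊃E′ (∀E′ (hyp′ h3) v1) (hyp′ h2)) v0) (hyp′ h1)) (hyp′ h0))))))))))
    where
    Δ₁ : List (Sch (𝟏 ⇒ 𝟏 ∷ Γ))
    Δ₁ = ∀ˢᵗ′ 𝟏 (∀ˢᵗ′ 𝟏 (WOˢᵗ v0 ⊃′ at₃ (P ˢᵗ) v1 v0 (v2 · ⟨ v1 , v0 ⟩)))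
         ∷ ⌜ st v0 ⌝ ∷ map ↑′ (UATRˢᵗ ∷ Δ)
    hs₁ : AllStandard Δ₁
    hs₁ x = there (consˢᵗ {Δ = UATRˢᵗ ∷ Δ} (there ∘ hs) x)
    hs₂ : AllStandard (⌜ st v0 ⌝ ∷ map ↑′ (⌜ st v0 ⌝ ∷ map ↑′ Δ₁))
    hs₂ = consˢᵗ {Δ = ⌜ st v0 ⌝ ∷ map ↑′ Δ₁} (consˢᵗ {Δ = Δ₁} hs₁)

  -- z codes ⟨f , X⟩ and y codes ⟨h , Y⟩: if X is a linear order, then h descends
  -- in X or Y is a solution for f and X.
  SolvesF : Formula (signature F) (𝟏 ∷ 𝟏 ∷ Fn ∷ Fn ∷ Fn ∷ [])
  SolvesF =
    l · X · X · X ≐ 0̇ ⊃ (¬̇ (d · X · X · (leftF · y) ≐ 0̇)) ⊃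
    p · (leftF · z) · X · (rightF · y) ≐ 0̇
    where
    y = v0
    z = v1
    X = rightF · z
    p = v2
    d = v3
    l = var (there (there (there (there (here refl)))))

  Solves : (l d p : Fn ∈ Γ) (z y : Tm Γ 𝟏) → Sch Γ
  Solves l d p z y = at SolvesF (y ∷ z ∷ var p ∷ var d ∷ var l ∷ [])

  -- With characteristic functions in place of `L`, `D` and `P`, the matrix of the solvability
  -- statement becomes quantifier-free, as QF-AC¹¹ demands.
  record Parameters {Γ : Ctx} (Δ : List (Sch Γ)) : Set where
    field
      m        : 𝟐 ∈ Γ
      l d p    : Fn ∈ Γ
      finds    : ⌜ FindsZero m ⌝ ∈ Δ
      char-L   : Char L l ∈ Δ
      char-D   : Char D d ∈ Δ
      char-P   : Char P p ∈ Δ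
      charˢᵗ-L : Charˢᵗ L l ∈ Δ
      charˢᵗ-D : Charˢᵗ D d ∈ Δ
      charˢᵗ-P : Charˢᵗ P p ∈ Δ

  open Parameters

  push : Parameters Δ → Parameters (A ∷ Δ)
  push E = record
    { m = m E ; l = l E ; d = d E ; p = p E ; finds = there (finds E)
    ; char-L = there (char-L E) ; char-D = there (char-D E) ; char-P = there (char-P E)
    ; charˢᵗ-L = there (charˢᵗ-L E) ; charˢᵗ-D = there (charˢᵗ-D E)
    ; charˢᵗ-P = there (charˢᵗ-P E) }

  shift : Parameters Δ → Parameters (map (↑′ {σ = σ}) Δ)
  shift E = record
    { m = there (m E) ; l = there (l E) ; d = there (d E) ; p = there (p E)
    ; finds = ∈-map⁺ ↑′ (finds E)
    ; char-L = ∈-map⁺ ↑′ (char-L E) ; char-D = ∈-map⁺ ↑′ (char-D E)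
    ; char-P = ∈-map⁺ ↑′ (char-P E)
    ; charˢᵗ-L = ∈-map⁺ ↑′ (charˢᵗ-L E) ; charˢᵗ-D = ∈-map⁺ ↑′ (charˢᵗ-D E)
    ; charˢᵗ-P = ∈-map⁺ ↑′ (charˢᵗ-P E) }

  -- Passing between formulas and their characteristic functions

  module _ {A : Formula (signature F) triple} {x : Fn ∈ Γ} {Δ : List (Sch Γ)}
           {f X Y : Tm Γ 𝟏} where

    private
      f≡ : subᵗ (single Y) (subᵗ (liftˢ (single X)) (↑ᵗ (↑ᵗ f))) ≡ f
      f≡ = trans (cong (subᵗ (single Y)) (trans (subᵗ-↑ᵗ (single X) (↑ᵗ f))
        (cong ↑ᵗ (single-↑ᵗ X f)))) (single-↑ᵗ Y f)

      X≡ : subᵗ (single Y) (↑ᵗ X) ≡ X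
      X≡ = single-↑ᵗ Y X

    Char-at : Char A x ∈ Δ → Δ ⊩ at₃ A f X Y ⇔′ vanishes (var x) f X Y
    Char-at c = subst₂ (λ f X → Δ ⊩ at₃ A f X Y ⇔′ vanishes (var x) f X Y) f≡ X≡
      (∀E′ (∀E′ (∀E′ (hyp′ c) f) X) Y)

    Charˢᵗ-at : Charˢᵗ A x ∈ Δ → Δ ⊩ ⌜ st f ⌝ → Δ ⊩ ⌜ st X ⌝ → Δ ⊩ ⌜ st Y ⌝ →
                Δ ⊩ at₃ (A ˢᵗ) f X Y ⇔′ vanishes (var x) f X Y
    Charˢᵗ-at c sf sX sY =
      subst₂ (λ f X → Δ ⊩ at₃ (A ˢᵗ) f X Y ⇔′ vanishes (var x) f X Y) f≡ X≡
        (⊃E′ (∀E′ (⊃E′ (∀E′ (⊃E′ (∀E′ (hyp′ c) f) sf) X)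
          sX) Y) sY)

    atI : Char A x ∈ Δ → Δ ⊩ vanishes (var x) f X Y → Δ ⊩ at₃ A f X Y
    atI c = ⊃E′ (∧E₂′ (Char-at c))

    atE : Char A x ∈ Δ → Δ ⊩ at₃ A f X Y → Δ ⊩ vanishes (var x) f X Y
    atE c = ⊃E′ (∧E₁′ (Char-at c))

    atˢᵗI : Charˢᵗ A x ∈ Δ → Δ ⊩ ⌜ st f ⌝ → Δ ⊩ ⌜ st X ⌝ → Δ ⊩ ⌜ st Y ⌝ →
            Δ ⊩ vanishes (var x) f X Y → Δ ⊩ at₃ (A ˢᵗ) f X Y
    atˢᵗI c sf sX sY = ⊃E′ (∧E₂′ (Charˢᵗ-at c sf sX sY))

    atˢᵗE : Charˢᵗ A x ∈ Δ → Δ ⊩ ⌜ st f ⌝ → Δ ⊩ ⌜ st X ⌝ → Δ ⊩ ⌜ st Y ⌝ →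
            Δ ⊩ at₃ (A ˢᵗ) f X Y → Δ ⊩ vanishes (var x) f X Y
    atˢᵗE c sf sX sY = ⊃E′ (∧E₁′ (Charˢᵗ-at c sf sX sY))

  WO′E : {Δ : List (Sch Γ)} {X h : Tm Γ 𝟏} → Δ ⊩ WO′ X → Δ ⊩ at₃ D X X h → Δ ⊩ ⌜ ⊥̇ ⌝
  WO′E {X = X} {h} w q = ⊃E′ (∧E₂′ w)
    (∃I′ h (subst (λ X → _ ⊩ at₃ D X X h) (sym (single-↑ᵗ h X)) q))

  WOˢᵗE : {Δ : List (Sch Γ)} {X h : Tm Γ 𝟏} → Δ ⊩ WOˢᵗ X → Δ ⊩ ⌜ st h ⌝ → Δ ⊩ at₃ (D ˢᵗ) X X h →
          Δ ⊩ ⌜ ⊥̇ ⌝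
  WOˢᵗE {X = X} {h} w sh q = ⊃E′ (∧E₂′ w)
    (∃I′ h (∧I′ sh (subst (λ X → _ ⊩ at₃ (D ˢᵗ) X X h) (sym (single-↑ᵗ h X)) q)))

  ≈-refl : {Δ : List (Sch Γ)} {t : Tm Γ 𝟏} → Δ ⊩ t ≈ t
  ≈-refl = ⊩I (Eq-refl 𝟏)

  ≈-sym : {Δ : List (Sch Γ)} {s t : Tm Γ 𝟏} → Δ ⊩ s ≈ t → Δ ⊩ t ≈ s
  ≈-sym (⊩I p) = ⊩I (⊃E (Eq-sym 𝟏) p)

  left-≈ : {Δ : List (Sch Γ)} (f X : 𝟏 ∈ Γ) → Δ ⊩ leftF · ⟨ var f , var X ⟩ ≈ var f
  left-≈ f X = ⊩I (left-⟨⟩ f X)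

  right-≈ : {Δ : List (Sch Γ)} (f X : 𝟏 ∈ Γ) → Δ ⊩ rightF · ⟨ var f , var X ⟩ ≈ var X
  right-≈ f X = ⊩I (right-⟨⟩ f X)

  replace : {Δ : List (Sch Γ)} (g : Tm Γ Fn) {f f′ X X′ Y Y′ : Tm Γ 𝟏} →
            Δ ⊩ f ≈ f′ → Δ ⊩ X ≈ X′ → Δ ⊩ Y ≈ Y′ → Δ ⊩ vanishes g f X Y → Δ ⊩ vanishes g f′ X′ Y′
  replace g {f} {f′} {X} {X′} {Y} {Y′} (⊩I e₁) (⊩I e₂) (⊩I e₃) (⊩I h) =
    ⊩I (≐-trans (≐-sym (Eq-app {s = Y} {Y′} (Eq-app {s = X} {X′} (ap g {f} {f′} e₁) e₂) e₃)) h)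

  module _ (l d p : Fn ∈ Γ) {z y : Tm Γ 𝟏} {Δ : List (Sch Γ)} where

    private
      X : Tm Γ 𝟏
      X = rightF · z

    SolvesI : (vanishes (var d) X X (leftF · y) ⊃′ ⌜ ⊥̇ ⌝) ∷ vanishes (var l) X X X ∷ Δ
              ⊩ vanishes (var p) (leftF · z) X (rightF · y) → Δ ⊩ Solves l d p z y
    SolvesI (⊩I q) = ⊩I (⊃I (⊃I q))

    SolvesE : Δ ⊩ Solves l d p z y → Δ ⊩ vanishes (var l) X X X →
              Δ ⊩ vanishes (var d) X X (leftF · y) ⊃′ ⌜ ⊥̇ ⌝ →
              Δ ⊩ vanishes (var p) (leftF · z) X (rightF · y)
    SolvesE (⊩I q) (⊩I ql) (⊩I qd) = ⊩I (⊃E (⊃E q ql) qd)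

    descending-Solves : {h : Tm Γ 𝟏} → Δ ⊩ leftF · y ≈ h → Δ ⊩ vanishes (var d) X X h →
                        Δ ⊩ Solves l d p z y
    descending-Solves e q = SolvesI (exFalso′ (⊃E′ (hyp′ h0)
      (weaken′ (there ∘ there) (replace (var d) ≈-refl ≈-refl (≈-sym e) q))))

    solution-Solves : {Y : Tm Γ 𝟏} → Δ ⊩ rightF · y ≈ Y → Δ ⊩ vanishes (var p) (leftF · z) X Y →
                      Δ ⊩ Solves l d p z y
    solution-Solves e q =
      SolvesI (weaken′ (there ∘ there) (replace (var p) ≈-refl ≈-refl (≈-sym e) q))

    nonorder-Solves : Δ ⊩ vanishes (var l) X X X ⊃′ ⌜ ⊥̇ ⌝ → Δ ⊩ Solves l d p z y
    nonorder-Solves q = SolvesI (exFalso′ (⊃E′ (weaken′ (there ∘ there) q) (hyp′ h1)))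

    Solves-decode : {f Z : Tm Γ 𝟏} →
      Δ ⊩ leftF · z ≈ f → Δ ⊩ X ≈ Z → Δ ⊩ Solves l d p z y →
      Δ ⊩ vanishes (var l) Z Z Z → Δ ⊩ vanishes (var d) Z Z (leftF · y) ⊃′ ⌜ ⊥̇ ⌝ →
      Δ ⊩ vanishes (var p) f Z (rightF · y)
    Solves-decode e₁ e₂ q ql qd = replace (var p) e₁ e₂ ≈-refl (SolvesE q
      (replace (var l) (≈-sym e₂) (≈-sym e₂) (≈-sym e₂) ql)
      (⊃I′ (⊃E′ (weaken′ there qd)
        (replace (var d) (weaken′ there e₂) (weaken′ there e₂) ≈-refl (hyp′ h0)))))

  -- Solvability from transfinite recursion

  Solvable : {Δ : List (Sch Γ)} → Parameters Δ → (z : 𝟏 ∈ Γ) → Sch Γ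
  Solvable E z = ∃′ 𝟏 (Solves (there (l E)) (there (d E)) (there (p E)) (var (there z)) v0)

  -- Three cases. A descending sequence serves as h; a linear order without one is a well-order, so
  -- the hypothesis yields Y; if there is no linear order, the first premise of `Solves` fails.
  solvable : {Δ : List (Sch Γ)} (E : Parameters Δ) (z : 𝟏 ∈ Γ) →
    Δ ⊩ WO′ (rightF · var z) ⊃′ ∃′ 𝟏 (at₃ P (leftF · var (there z)) (rightF · var (there z)) v0) →
    Δ ⊩ Solvable E z
  solvable {Γ} {Δ} E z q = byCases′ (∃′ 𝟏 descends)
    (∃E′ {A = descends} (hyp′ h0) by-sequence)
    (byCases′ (vanishes (var (l E)) X X X)
      (∃E′ {A = solution} (⊃E′ (weaken′ (there ∘ there) q) well-ordered) by-solution)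
      -- Any object of type 1 will do, and `z` is at hand.
      (∃I′ (var z) (nonorder-Solves (l E) (d E) (p E) (hyp′ h0))))
    where
    X : Tm Γ 𝟏
    X = rightF · var z
    X′ : Tm (𝟏 ∷ Γ) 𝟏
    X′ = rightF · var (there z)
    descends solution : Sch (𝟏 ∷ Γ)
    descends = vanishes (var (there (d E))) X′ X′ v0
    solution = at₃ P (leftF · var (there z)) X′ v0
    Δ₂ : List (Sch Γ)
    Δ₂ = vanishes (var (l E)) X X X ∷ (∃′ 𝟏 descends ⊃′ ⌜ ⊥̇ ⌝) ∷ Δ
    Δ₃ : List (Sch Γ)
    Δ₃ = ∃′ 𝟏 (at₃ D X′ X′ v0) ∷ Δ₂
    E₃ : Parameters Δ₂
    E₃ = push (push E)
    by-sequence : descends ∷ map ↑′ (∃′ 𝟏 descends ∷ Δ) ⊩ ↑′ (Solvable E z)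
    -- Only the left component matters in this case, so the sequence fills both.
    by-sequence = ∃I′ ⟨ v0 , v0 ⟩
      (descending-Solves (there (l E)) (there (d E)) (there (p E)) (left-≈ h0 h0) (hyp′ h0))
    well-ordered : Δ₂ ⊩ WO′ X
    well-ordered = ∧I′ (atI (char-L E₃) (hyp′ h0))
      (⊃I′ (∃E′ {A = at₃ D X′ X′ v0} (hyp′ h0) (⊃E′ (hyp′ h3)
        (∃I′ v0 (atE (char-D (push (shift {Δ = Δ₃} (push E₃)))) (hyp′ h0))))))
    by-solution : solution ∷ map ↑′ Δ₂ ⊩ ↑′ (Solvable E z)
    by-solution = ∃I′ ⟨ v0 , v0 ⟩
      (solution-Solves (there (l E)) (there (d E)) (there (p E)) (right-≈ h0 h0)
        (atE (char-P (push (shift {Δ = Δ₂} E₃))) (hyp′ h0)))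

  Solvableˢᵗ : {Δ : List (Sch Γ)} → Parameters Δ → (z : 𝟏 ∈ Γ) → Sch Γ
  Solvableˢᵗ E z = ∃ˢᵗ′ 𝟏 (Solves (there (l E)) (there (d E)) (there (p E)) (var (there z)) v0)

  opened : Sch (σ ∷ Γ) → List (Sch Γ) → List (Sch (σ ∷ Γ))
  opened A Δ = A ∷ ⌜ st v0 ⌝ ∷ map ↑′ Δ

  open-standard : {A : Sch (σ ∷ Γ)} {Δ : List (Sch Γ)} → AllStandard Δ → AllStandard (opened A Δ)
  open-standard hs x = there (consˢᵗ hs x)

  open-parameters : {A : Sch (σ ∷ Γ)} {Δ : List (Sch Γ)} → Parameters Δ → Parameters (opened A Δ)
  open-parameters E = push (push (shift E))

  -- The cases split on standard descending sequences, since those are what relativised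
  -- well-foundedness excludes. Every witness is assembled from standard objects and so remains
  -- standard.
  solvableˢᵗ : {Δ : List (Sch Γ)} (E : Parameters Δ) → AllStandard Δ → (z : 𝟏 ∈ Γ) →
    Δ ⊩ WOˢᵗ (rightF · var z) ⊃′
      ∃ˢᵗ′ 𝟏 (at₃ (P ˢᵗ) (leftF · var (there z)) (rightF · var (there z)) v0) →
    Δ ⊩ Solvableˢᵗ E z
  solvableˢᵗ {Γ} {Δ} E hs z q = byCases′ (∃ˢᵗ′ 𝟏 descends)
    (∃ˢᵗE {A = descends} (hyp′ h0) by-sequence)
    (byCases′ (vanishes (var (l E)) X X X)
      (∃ˢᵗE {A = solution} (⊃E′ (weaken′ (there ∘ there) q) well-ordered) by-solution)
      (∃I′ (var z) (∧I′ (hyp′ (there (there (hs z))))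
        (nonorder-Solves (l E) (d E) (p E) (hyp′ h0)))))
    where
    X : Tm Γ 𝟏
    X = rightF · var z
    X′ : Tm (𝟏 ∷ Γ) 𝟏
    X′ = rightF · var (there z)
    descends solution : Sch (𝟏 ∷ Γ)
    descends = vanishes (var (there (d E))) X′ X′ v0
    solution = at₃ (P ˢᵗ) (leftF · var (there z)) X′ v0
    Δ₂ : List (Sch Γ)
    Δ₂ = vanishes (var (l E)) X X X ∷ (∃ˢᵗ′ 𝟏 descends ⊃′ ⌜ ⊥̇ ⌝) ∷ Δ
    hs₂ : AllStandard Δ₂
    hs₂ x = there (there (hs x))
    E₃ : Parameters Δ₂
    E₃ = push (push E)
    Δ₃ : List (Sch Γ)
    Δ₃ = ∃ˢᵗ′ 𝟏 (at₃ (D ˢᵗ) X′ X′ v0) ∷ Δ₂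
    by-sequence : opened descends (∃ˢᵗ′ 𝟏 descends ∷ Δ) ⊩ ↑′ (Solvableˢᵗ E z)
    by-sequence = ∃I′ ⟨ v0 , v0 ⟩ (∧I′
      (st′ (open-standard {Δ = ∃ˢᵗ′ 𝟏 descends ∷ Δ} (there ∘ hs)) ⟨ v0 , v0 ⟩)
      (descending-Solves (there (l E)) (there (d E)) (there (p E)) (left-≈ h0 h0) (hyp′ h0)))
    X-standard : opened (at₃ (D ˢᵗ) X′ X′ v0) Δ₃ ⊩ ⌜ st X′ ⌝
    X-standard = st′ (open-standard {Δ = Δ₃} (there ∘ hs₂)) X′
    well-ordered : Δ₂ ⊩ WOˢᵗ X
    well-ordered = ∧I′
      (atˢᵗI (charˢᵗ-L E₃) (st′ hs₂ X) (st′ hs₂ X) (st′ hs₂ X) (hyp′ h0))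
      (⊃I′ (∃ˢᵗE {A = at₃ (D ˢᵗ) X′ X′ v0} (hyp′ h0) (⊃E′ (hyp′ h4) (∃I′ v0 (∧I′ (hyp′ h1)
        (atˢᵗE (charˢᵗ-D (open-parameters {Δ = Δ₃} (push E₃)))
          X-standard X-standard (hyp′ h1) (hyp′ h0)))))))
    S-standard : (t : Tm (𝟏 ∷ Γ) 𝟏) → opened solution Δ₂ ⊩ ⌜ st t ⌝
    S-standard = st′ (open-standard {Δ = Δ₂} hs₂)
    by-solution : opened solution Δ₂ ⊩ ↑′ (Solvableˢᵗ E z)
    by-solution = ∃I′ ⟨ v0 , v0 ⟩ (∧I′ (S-standard ⟨ v0 , v0 ⟩)
      (solution-Solves (there (l E)) (there (d E)) (there (p E)) (right-≈ h0 h0)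
        (atˢᵗE (charˢᵗ-P (open-parameters {Δ = Δ₂} E₃))
          (S-standard (leftF · var (there z))) (S-standard X′) (hyp′ h1) (hyp′ h0))))

  -- Here `L`, `D` and `P` are written out, which leaves only the variables of `z` and `y` free.
  -- `Solves` has in addition the parameters `l`, `d`, `p`, which transfer forbids.
  Solves′ : (z y : Tm Γ 𝟏) → Sch Γ
  Solves′ z y = at₃ L X X X ⊃′ (at₃ D X X (leftF · y) ⊃′ ⌜ ⊥̇ ⌝) ⊃′ at₃ P (leftF · z) X (rightF · y)
    where X = rightF · z

  module _ {Δ : List (Sch Γ)} (E : Parameters Δ) {z y : Tm Γ 𝟏} where

    Solves⇒Solves′ : Δ ⊩ Solves (l E) (d E) (p E) z y → Δ ⊩ Solves′ z y
    Solves⇒Solves′ q = ⊃I′ (⊃I′ (atI (char-P E₀)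
      (SolvesE (l E₀) (d E₀) (p E₀) (weaken′ (there ∘ there) q)
        (atE (char-L E₀) (hyp′ h1))
        (⊃I′ (⊃E′ (hyp′ h1) (atI (char-D (push E₀)) (hyp′ h0)))))))
      where
      X = rightF · z
      E₀ : Parameters ((at₃ D X X (leftF · y) ⊃′ ⌜ ⊥̇ ⌝) ∷ at₃ L X X X ∷ Δ)
      E₀ = push (push E)

    Solves′⇒Solves : Δ ⊩ Solves′ z y → Δ ⊩ Solves (l E) (d E) (p E) z y
    Solves′⇒Solves q = SolvesI (l E) (d E) (p E) (atE (char-P (push (push E)))
      (⊃E′ (⊃E′ (weaken′ (there ∘ there) q)
      (atI (char-L (push (push E))) (hyp′ h1)))
      (⊃I′ (⊃E′ (hyp′ h1) (atE (char-D (push (push (push E)))) (hyp′ h0))))))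

  Solves′-internal : {z y : Tm Γ 𝟏} → Internal ⌊ Solves′ z y ⌋
  Solves′-internal =
    internal-at L L-arithmetical ,
    (internal-at D D-arithmetical , _) , internal-at P P-arithmetical
    where
    internal-at : (A : Formula Sg Γ) {s : Subst Sg Γ Θ} → Arithmetical A → Internal (sub s A)
    internal-at A {s} a = arithmetical-internal (sub s A) (arithmetical-sub s A a)

  -- Choice functionals and transfer

  AllSolvable : {Δ : List (Sch Γ)} → Parameters Δ → Sch Γ
  AllSolvable E = ∀′ 𝟏 (Solvable (shift E) h0)

  Solution : {Δ : List (Sch Γ)} → Parameters Δ → Sch (𝟏 ⇒ 𝟏 ∷ Γ)
  Solution E = ∀′ 𝟏 (Solves (there (there (l E))) (there (there (d E))) (there (there (p E)))
    v0 (v1 · v0))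

  module _ {Δ : List (Sch Γ)} (E : Parameters Δ) where

    ATR⊃AllSolvable : Δ ⊩ ATR′ ⊃′ AllSolvable E
    ATR⊃AllSolvable = ⊃I′ (∀I′ (solvable (shift {Δ = ATR′ ∷ Δ} (push E)) h0
      (∀E′ (∀E′ (hyp′ h0) (leftF · v0)) (rightF · v0))))

    -- `ATR*′` makes every standard z solvable, since by absoluteness a standard relativised
    -- hierarchy is a true one. Written with `Solves′`, solvability has no parameters and transfers
    -- to all z.
    ATR*⊃AllSolvable : AllStandard Δ → Δ ⊩ ATR*′ ⊃′ AllSolvable E
    ATR*⊃AllSolvable hs = ⊃I′ (cut′
      (∀-transfer′ (∃′ 𝟏 (Solves′ v1 v0)) Solves′-internal
        (∀I′ (⊃I′ (∃E′ (solvable E₁ h0 (⊃I′ solution))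
          (∃I′ v0 (Solves⇒Solves′ (push (shift {Δ = Δ₁} E₁)) (hyp′ h0)))))))
      (∀I′ (∃E′ {A = Solves′ v1 v0} (∀E′ (hyp′ h0) v0) (∃I′ v0 (Solves′⇒Solves E₀ (hyp′ h0))))))
      where
      Δ₁ : List (Sch (𝟏 ∷ Γ))
      Δ₁ = ⌜ st v0 ⌝ ∷ map ↑′ (ATR*′ ∷ Δ)
      E₁ : Parameters Δ₁
      E₁ = push (shift {Δ = ATR*′ ∷ Δ} (push E))
      Δ₂ : List (Sch (𝟏 ∷ Γ))
      Δ₂ = map ↑′ (∀′ 𝟏 (∃′ 𝟏 (Solves′ v1 v0)) ∷ ATR*′ ∷ Δ)
      E₀ : Parameters (Solves′ v1 v0 ∷ map ↑′ Δ₂)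
      E₀ = push (shift {Δ = Δ₂} (shift {Δ = ∀′ 𝟏 (∃′ 𝟏 (Solves′ v1 v0)) ∷ ATR*′ ∷ Δ}
        (push (push E))))
      Δ₃ : List (Sch (𝟏 ∷ Γ))
      Δ₃ = WO′ (rightF · v0) ∷ Δ₁
      hs₃ : AllStandard Δ₃
      hs₃ x = there (consˢᵗ {Δ = ATR*′ ∷ Δ} (there ∘ hs) x)
      solves : Sch (𝟏 ∷ 𝟏 ∷ Γ)
      solves = at₃ (P ˢᵗ) (leftF · v1) (rightF · v1) v0
      S-standard : (t : Tm (𝟏 ∷ 𝟏 ∷ Γ) 𝟏) → opened solves Δ₃ ⊩ ⌜ st t ⌝
      S-standard = st′ (open-standard {Δ = Δ₃} hs₃)
      solution : Δ₃ ⊩ ∃′ 𝟏 (at₃ P (leftF · v1) (rightF · v1) v0)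
      solution = ∃ˢᵗE {A = solves}
        (⊃E′ (⊃E′ (∀E′ (⊃E′ (∀E′ (hyp′ h2) (leftF · v0)) (st′ hs₃ (leftF · v0)))
          (rightF · v0)) (st′ hs₃ (rightF · v0))) (hyp′ h0))
        (∃I′ v0 (atI (char-P E₃) (atˢᵗE (charˢᵗ-P E₃)
          (S-standard (leftF · v1)) (S-standard (rightF · v1)) (hyp′ h1) (hyp′ h0))))
        where
        E₃ : Parameters (opened solves Δ₃)
        E₃ = open-parameters {Δ = Δ₃} (push E₁)

    -- A standard well-order is one in the relativised sense: being a linear order is absolute, and
    -- a standard sequence that descends in the relativised sense does descend.
    ATRˢᵗ⊃ATR* : AllStandard Δ → Δ ⊩ ATRˢᵗ ⊃′ ATR*′
    ATRˢᵗ⊃ATR* hs = ⊃I′ (∀I′ (⊃I′ (∀I′ (⊃I′ (⊃I′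
      (⊃E′ (⊃E′ (∀E′ (⊃E′ (∀E′ (hyp′ h3) v1) (hyp′ h2)) v0) (hyp′ h1)) (∧I′
        (atˢᵗI (charˢᵗ-L E₀) (hyp′ h1) (hyp′ h1) (hyp′ h1) (atE (char-L E₀) (∧E₁′ (hyp′ h0))))
        (⊃I′ (∃ˢᵗE (hyp′ h0) (WO′E (hyp′ h3)
          (atI (char-D E₃) (atˢᵗE (charˢᵗ-D E₃) (hyp′ h4) (hyp′ h4) (hyp′ h1) (hyp′ h0)))))))))))))
      where
      Δ₁ : List (Sch (𝟏 ∷ Γ))
      Δ₁ = ⌜ st v0 ⌝ ∷ map ↑′ (ATRˢᵗ ∷ Δ)
      Δ₂ : List (Sch (𝟏 ∷ 𝟏 ∷ Γ))
      Δ₂ = WO′ v0 ∷ ⌜ st v0 ⌝ ∷ map ↑′ Δ₁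
      E₀ : Parameters Δ₂
      E₀ = push (push (shift {Δ = Δ₁} (push (shift {Δ = ATRˢᵗ ∷ Δ} (push E)))))
      Δ₃ : List (Sch (𝟏 ∷ 𝟏 ∷ Γ))
      Δ₃ = ∃ˢᵗ′ 𝟏 (at₃ (D ˢᵗ) v1 v1 v0) ∷ Δ₂
      E₃ : Parameters (opened (at₃ (D ˢᵗ) v1 v1 v0) Δ₃)
      E₃ = open-parameters {Δ = Δ₃} (push E₀)

    -- The characteristic functions are traded for `Solves′` before the transfer and restored after
    -- it.
    Solution-transfer : Δ ⊩ ∃′ (𝟏 ⇒ 𝟏) (Solution E) ⊃′ ∃ˢᵗ′ (𝟏 ⇒ 𝟏) (Solution E)
    Solution-transfer = ⊃I′ (∃ˢᵗE {A = Solution′}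
      (∃-transfer′ (∀′ 𝟏 (Solves′ v0 (v1 · v0))) Solves′-internal
        (∃E′ {A = Solution E} (hyp′ h0) (∃I′ v0 (∀I′ (Solves⇒Solves′ (shift {Δ = Δ₂} E₀)
          (∀E′ (hyp′ h0) v0))))))
      (∃I′ v0 (∧I′ (hyp′ h1) (∀I′ (Solves′⇒Solves (shift {Δ = opened Solution′ Δ₁} E₁)
        (∀E′ (hyp′ h0) v0))))))
      where
      Solution′ : Sch (𝟏 ⇒ 𝟏 ∷ Γ)
      Solution′ = ∀′ 𝟏 (Solves′ v0 (v1 · v0))
      Δ₁ : List (Sch Γ)
      Δ₁ = ∃′ (𝟏 ⇒ 𝟏) (Solution E) ∷ Δ
      E₁ : Parameters (opened Solution′ Δ₁)
      E₁ = open-parameters {Δ = Δ₁} (push E)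
      Δ₂ : List (Sch (𝟏 ⇒ 𝟏 ∷ Γ))
      Δ₂ = Solution E ∷ map ↑′ Δ₁
      E₀ : Parameters Δ₂
      E₀ = push (shift {Δ = Δ₁} (push E))

    -- Relativised well-foundedness excludes only standard descents. The functional being standard,
    -- the left component of its value at a standard ⟨f , X⟩ is standard and cannot descend, so the
    -- right component is a solution.
    Solution⊃ATRˢᵗ : AllStandard Δ → Δ ⊩ ∃ˢᵗ′ (𝟏 ⇒ 𝟏) (Solution E) ⊃′ ATRˢᵗ
    Solution⊃ATRˢᵗ hs = ⊃I′ (∃ˢᵗE {A = Solution E} (hyp′ h0) (∀I′ (⊃I′ (∀I′ (⊃I′ (⊃I′
      (∃I′ (rightF · y) (∧I′ (st′ hs₃ (rightF · y))
        (atˢᵗI (charˢᵗ-P E₃) (hyp′ h2) (hyp′ h1) (st′ hs₃ (rightF · y))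
          (Solves-decode (l E₃) (d E₃) (p E₃) (left-≈ h1 h0) (right-≈ h1 h0)
            (∀E′ (hyp′ h3) ⟨ v1 , v0 ⟩)
            (atˢᵗE (charˢᵗ-L E₃) (hyp′ h1) (hyp′ h1) (hyp′ h1) (∧E₁′ (hyp′ h0)))
            (⊃I′ (WOˢᵗE (hyp′ h1) (st′ (there ∘ hs₃) (leftF · y))
              (atˢᵗI (charˢᵗ-D (push E₃)) (hyp′ h2) (hyp′ h2) (st′ (there ∘ hs₃) (leftF · y))
                (hyp′ h0))))))))))))))
      where
      y : Tm (𝟏 ∷ 𝟏 ∷ 𝟏 ⇒ 𝟏 ∷ Γ) 𝟏
      y = v2 · ⟨ v1 , v0 ⟩
      Δ₀ : List (Sch Γ)
      Δ₀ = ∃ˢᵗ′ (𝟏 ⇒ 𝟏) (Solution E) ∷ Δ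
      Δ₁ : List (Sch (𝟏 ⇒ 𝟏 ∷ Γ))
      Δ₁ = opened (Solution E) Δ₀
      Δ₂ : List (Sch (𝟏 ∷ 𝟏 ⇒ 𝟏 ∷ Γ))
      Δ₂ = ⌜ st v0 ⌝ ∷ map ↑′ Δ₁
      Δ₃ : List (Sch (𝟏 ∷ 𝟏 ∷ 𝟏 ⇒ 𝟏 ∷ Γ))
      Δ₃ = WOˢᵗ v0 ∷ ⌜ st v0 ⌝ ∷ map ↑′ Δ₂
      hs₃ : AllStandard Δ₃
      hs₃ x = there (consˢᵗ {Δ = Δ₂} (consˢᵗ {Δ = Δ₁} (open-standard {Δ = Δ₀} (there ∘ hs))) x)
      E₃ : Parameters Δ₃
      E₃ = push (push (shift {Δ = Δ₂} (push (shift {Δ = Δ₁} (open-parameters {Δ = Δ₀} (push E))))))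

    Solution⊃UATR : Δ ⊩ ∃′ (𝟏 ⇒ 𝟏) (Solution E) ⊃′ UATR′
    Solution⊃UATR = ⊃I′ (∃E′ {A = Solution E} (hyp′ h0)
      -- In a true well-order no sequence descends, so the right component of the chosen pair is
      -- always a solution.
      (∃I′ (lam (rightF · (v1 · v0))) (∀I′ (∀I′ (⊃I′ (atI (char-P E₃)
        (replace (var (p E₃)) ≈-refl ≈-refl (≈-sym Φ-β)
          (Solves-decode (l E₃) (d E₃) (p E₃) (left-≈ h1 h0) (right-≈ h1 h0)
            (∀E′ (hyp′ h1) ⟨ v1 , v0 ⟩) (atE (char-L E₃) (∧E₁′ (hyp′ h0)))
            (⊃I′ (WO′E (hyp′ h1) (atI (char-D (push E₃)) (hyp′ h0))))))))))))
      where
      Δ₀ : List (Sch Γ)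
      Δ₀ = ∃′ (𝟏 ⇒ 𝟏) (Solution E) ∷ Δ
      Δ₁ : List (Sch (𝟏 ⇒ 𝟏 ∷ Γ))
      Δ₁ = Solution E ∷ map ↑′ Δ₀
      Δ₃ : List (Sch (𝟏 ∷ 𝟏 ∷ 𝟏 ⇒ 𝟏 ∷ Γ))
      Δ₃ = WO′ v0 ∷ map ↑′ (map ↑′ Δ₁)
      E₃ : Parameters Δ₃
      E₃ = push (shift {Δ = map ↑′ Δ₁} (shift {Δ = Δ₁} (push (shift {Δ = Δ₀} (push E)))))
      Φ-β : Δ₃ ⊩ lam (rightF · (v3 · v0)) · ⟨ v1 , v0 ⟩ ≈ rightF · (v2 · ⟨ v1 , v0 ⟩)
      Φ-β = ⊩I (β var (rightF · (v3 · v0)) ⟨ v1 , v0 ⟩)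

  -- Literally an instance of QF-AC¹¹, since `Solves` is a propositional combination of equations in
  -- `l`, `d` and `p`.
  AllSolvable⊃Solution : (∀ {Γ A} → QF-AC (signature F) 𝟏 𝟏 Γ A → T Γ A) →
    {Δ : List (Sch Γ)} (E : Parameters Δ) → Δ ⊩ AllSolvable E ⊃′ ∃′ (𝟏 ⇒ 𝟏) (Solution E)
  AllSolvable⊃Solution ac E = ⊩I (axiom (ac (qf-ac
    ⌊ Solves (there (there (l E))) (there (there (d E))) (there (there (p E))) v1 v0 ⌋ _)))

  -- Selecting a solution from a finite list of candidates

  st-element : {Δ : List (Formula (signature F) Γ)} {s : Tm Γ (σ *)} {y : Tm Γ σ} →
               T ∣ Δ ⊢ st s → T ∣ Δ ⊢ y ∈̇ s → T ∣ Δ ⊢ st y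
  -- The element equals an entry of `s`; the length of `s` is standard, hence so are the index and
  -- the entry.
  st-element {s = s} {y} p q = cut p (∃E (wk q) (⊃E (⊃E (axiom (Ω (st-Eq _ (↑ᵗ y)))) (∧E₂ (hyp h0)))
    (app (app (axiom (Ω (st-closed (con entry)))) (hyp h1)) st-index)))
    where
    app : ∀ {Γ σ τ} {Δ : List (Formula (signature F) Γ)} {f : Tm Γ (σ ⇒ τ)} {t : Tm Γ σ} →
          T ∣ Δ ⊢ st f → T ∣ Δ ⊢ st t → T ∣ Δ ⊢ st (f · t)
    app p q = ⊃E (⊃E (axiom (Ω (st-app _ _))) p) q
    -- Only ṡ i is bounded by the length.
    st-index : T ∣ _ ⊢ st v0
    st-index = ⊃E (⊃E (axiom (Ω (st-Eq _ v0))) (predecessor-suc v0))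
      (app (axiom (Ω (st-closed predecessor)))
        (⊃E (⊃E (axiom (Ω (st-≤ (ṡ v0) (con len · ↑ᵗ s)))) (∧E₁ (hyp h0)))
          (app (axiom (Ω (st-closed (con len)))) (hyp h1))))

  -- The solution in the finite list Φ z, found by searching for its index.  The
  -- index found may exceed the length of Φ z: the entry there is a solution too.
  module _ (m : 𝟐 ∈ Γ) (p : Fn ∈ Γ) (Φ : (𝟏 ⇒ 𝟏 *) ∈ Γ) where

    test : Tm (o ∷ 𝟏 ∷ Γ) o
    test = var (there (there p)) · (leftF · v1) · (rightF · v1) ·
      (rightF · (con entry · (var (there (there Φ)) · v1) · v0))

    choose : Tm (𝟏 ∷ Γ) 𝟏
    choose = rightF · (con entry · (var (there Φ) · v0) · (var (there m) · lam test))

    choose-entry : {Δ : List (Sch Γ)} → ⌜ FindsZero m ⌝ ∈ Δ → (z : Tm Γ 𝟏) {i : Tm Γ o} →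
      Δ ⊩ vanishes (var p) (leftF · z) (rightF · z) (rightF · (con entry · (var Φ · z) · i)) →
      Δ ⊩ vanishes (var p) (leftF · z) (rightF · z) (lam choose · z)
    choose-entry {Δ} h z {i} (⊩I q) = replace (var p) ≈-refl ≈-refl (≈-sym choose-β)
      (⊩I (≐-trans (≐-sym (β (var ▹ z) test (var m · g)))
        (find m (∈-map⁺ ⌊_⌋ h) g (≐-trans (β (var ▹ z) test i) q))))
      where
      g : Tm Γ 𝟏
      g = subᵗ (var ▹ z) (lam test)
      choose-β : Δ ⊩ lam choose · z ≈ rightF · (con entry · (var Φ · z) · (var m · g))
      choose-β = ⊩I (β var choose z)

  choose-element : (m : 𝟐 ∈ Γ) (p : Fn ∈ Γ) (Φ : (𝟏 ⇒ 𝟏 *) ∈ Γ) {Δ : List (Sch Γ)} →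
    ⌜ FindsZero m ⌝ ∈ Δ → (z y : Tm Γ 𝟏) → Δ ⊩ y ∈′ var Φ · z →
    Δ ⊩ vanishes (var p) (leftF · z) (rightF · z) (rightF · y) →
    Δ ⊩ vanishes (var p) (leftF · z) (rightF · z) (lam (choose m p Φ) · z)
  choose-element {Γ} m p Φ {Δ} h z y q r = cut′ r (∃E′ {A = at-index} (⊩I (wk (⊩E q)))
    (choose-entry (there m) (there p) (there Φ) (there (∈-map⁺ ↑′ (there h))) (↑ᵗ z)
      (replace (var (there p)) ≈-refl ≈-refl same (hyp′ h1))))
    where
    at-index : Sch (o ∷ Γ)
    at-index = ⌜ v0 <̇ con len · (var (there Φ) · ↑ᵗ z) ∧
      Eq 𝟏 (con entry · (var (there Φ) · ↑ᵗ z) · v0) (↑ᵗ y) ⌝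
    same : at-index ∷ map ↑′ (vanishes (var p) (leftF · z) (rightF · z) (rightF · y) ∷ Δ)
           ⊩ rightF · ↑ᵗ y ≈ rightF · (con entry · (var (there Φ) · ↑ᵗ z) · v0)
    same = ⊩I (ap rightF (⊃E (Eq-sym 𝟏) (∧E₂ (hyp h0))))

  -- The candidate y lies in a standard list and is therefore standard, so its left component cannot
  -- descend in X. Its right component is then a solution, and the search returns a solution,
  -- perhaps another one.
  choose-solution : {Δ : List (Sch Γ)} (E : Parameters Δ) (Φ : (𝟏 ⇒ 𝟏 *) ∈ Γ) {f X z y : Tm Γ 𝟏} →
    Δ ⊩ leftF · z ≈ f → Δ ⊩ rightF · z ≈ X → Δ ⊩ ⌜ st X ⌝ → Δ ⊩ ⌜ st (var Φ · z) ⌝ →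
    Δ ⊩ y ∈′ var Φ · z → Δ ⊩ Solves (l E) (d E) (p E) z y → Δ ⊩ WOˢᵗ X →
    Δ ⊩ vanishes (var (p E)) f X (lam (choose (m E) (p E) Φ) · z)
  choose-solution {Γ} {Δ} E Φ {f} {X} {z} {y} e₁ e₂ st-X st-Φz y∈Φz q w =
    replace (var (p E)) e₁ e₂ ≈-refl (choose-element (m E) (p E) Φ (finds E) z y y∈Φz
      (replace (var (p E)) (≈-sym e₁) (≈-sym e₂) ≈-refl
        (Solves-decode (l E) (d E) (p E) e₁ e₂ q
          (atˢᵗE (charˢᵗ-L E) st-X st-X st-X (∧E₁′ w))
          (⊃I′ (WOˢᵗE (weaken′ there w) (weaken′ there st-h) (atˢᵗI (charˢᵗ-D (push E))
            (weaken′ there st-X) (weaken′ there st-X) (weaken′ there st-h) (hyp′ h0)))))))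
    where
    st-h : Δ ⊩ ⌜ st (leftF · y) ⌝
    st-h = ⊩I (axiom (Ω (st-closed leftF))) ⊛ ⊩I (st-element (⊩E st-Φz) (⊩E y∈Φz))

  module _ {Δ : List (Sch Γ)} (E : Parameters Δ) (hs : AllStandard Δ) where

    Candidates : Sch (𝟏 ⇒ 𝟏 * ∷ Γ)
    Candidates = ∀ˢᵗ′ 𝟏 (∃′ 𝟏 (v0 ∈′ v2 · v1 ∧′ Solves
      (there (there (there (l E)))) (there (there (there (d E))))
      (there (there (there (p E)))) v1 v0))

    -- `solvableˢᵗ` provides the premise of HAC_int, whose matrix `Solves` is internal because
    -- characteristic functions stand in for the relativised formulas.
    ATRˢᵗ⊃Candidates : Δ ⊩ ATRˢᵗ ⊃′ ∃ˢᵗ′ (𝟏 ⇒ 𝟏 *) Candidates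
    ATRˢᵗ⊃Candidates = (⊃I′ (∀I′ (⊃I′ (solvableˢᵗ E₁ hs₁ h0
        (⊃E′ (∀E′ (⊃E′ (∀E′ (hyp′ h1) (leftF · v0)) (st′ hs₁ (leftF · v0))) (rightF · v0))
          (st′ hs₁ (rightF · v0))))))) ⨾
      ⊩I {A = ∀ˢᵗ′ 𝟏 (Solvableˢᵗ (shift E) h0) ⊃′ ∃ˢᵗ′ (𝟏 ⇒ 𝟏 *) Candidates} (axiom (Ω (HAC-int
        ⌊ Solves (there (there (l E))) (there (there (d E))) (there (there (p E))) v1 v0 ⌋ _)))
      where
      hs₁ : AllStandard (⌜ st v0 ⌝ ∷ map ↑′ (ATRˢᵗ ∷ Δ))
      hs₁ = consˢᵗ {Δ = ATRˢᵗ ∷ Δ} (there ∘ hs)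
      E₁ : Parameters (⌜ st v0 ⌝ ∷ map ↑′ (ATRˢᵗ ∷ Δ))
      E₁ = push (shift {Δ = ATRˢᵗ ∷ Δ} (push E))

    -- The selector built from `choose` is a term in the list functional, the search operator and
    -- `p`, all standard; hence it is standard.
    Candidates⊃UATRˢᵗ : Δ ⊩ ∃ˢᵗ′ (𝟏 ⇒ 𝟏 *) Candidates ⊃′ UATRˢᵗ
    Candidates⊃UATRˢᵗ = ⊃I′ (∃ˢᵗE {A = Candidates} (hyp′ h0)
      (∃I′ Ψ (∧I′ (st′ hs₁ Ψ) (∀I′ (⊃I′ (∀I′ (⊃I′ (⊃I′
        (atˢᵗI (charˢᵗ-P E₃) (hyp′ h2) (hyp′ h1) (st′ hs₃ (Ψ₃ · ⟨ v1 , v0 ⟩)) solution)))))))))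
      where
      Ψ : Tm (𝟏 ⇒ 𝟏 * ∷ Γ) (𝟏 ⇒ 𝟏)
      Ψ = lam (choose (there (m E)) (there (p E)) h0)
      Δ₀ : List (Sch Γ)
      Δ₀ = ∃ˢᵗ′ (𝟏 ⇒ 𝟏 *) Candidates ∷ Δ
      Δ₁ : List (Sch (𝟏 ⇒ 𝟏 * ∷ Γ))
      Δ₁ = opened Candidates Δ₀
      Δ₂ : List (Sch (𝟏 ∷ 𝟏 ⇒ 𝟏 * ∷ Γ))
      Δ₂ = ⌜ st v0 ⌝ ∷ map ↑′ Δ₁
      Δ₃ : List (Sch (𝟏 ∷ 𝟏 ∷ 𝟏 ⇒ 𝟏 * ∷ Γ))
      Δ₃ = WOˢᵗ v0 ∷ ⌜ st v0 ⌝ ∷ map ↑′ Δ₂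
      hs₁ : AllStandard Δ₁
      hs₁ = open-standard {Δ = Δ₀} (there ∘ hs)
      hs₃ : AllStandard Δ₃
      hs₃ x = there (consˢᵗ {Δ = Δ₂} (consˢᵗ {Δ = Δ₁} hs₁) x)
      E₃ : Parameters Δ₃
      E₃ = push (push (shift {Δ = Δ₂} (push (shift {Δ = Δ₁} (open-parameters {Δ = Δ₀} (push E))))))
      Ψ₃ : Tm (𝟏 ∷ 𝟏 ∷ 𝟏 ⇒ 𝟏 * ∷ Γ) (𝟏 ⇒ 𝟏)
      Ψ₃ = lam (choose (m E₃) (p E₃) h2)
      candidate : Sch (𝟏 ∷ 𝟏 ∷ 𝟏 ∷ 𝟏 ⇒ 𝟏 * ∷ Γ)
      candidate = v0 ∈′ v3 · ⟨ v2 , v1 ⟩ ∧′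
        Solves (there (l E₃)) (there (d E₃)) (there (p E₃)) ⟨ v2 , v1 ⟩ v0
      Δ₄ : List (Sch (𝟏 ∷ 𝟏 ∷ 𝟏 ⇒ 𝟏 * ∷ Γ))
      Δ₄ = ⌜ st (v2 · ⟨ v1 , v0 ⟩) ⌝ ∷ Δ₃
      E₄ : Parameters (candidate ∷ map ↑′ Δ₄)
      E₄ = push (shift {Δ = Δ₄} (push E₃))
      solution : Δ₃ ⊩ vanishes (var (p E₃)) v1 v0 (Ψ₃ · ⟨ v1 , v0 ⟩)
      solution = cut′ (st′ hs₃ (v2 · ⟨ v1 , v0 ⟩)) (∃E′ {A = candidate}
        (⊃E′ (∀E′ (hyp′ h4) ⟨ v1 , v0 ⟩) (st′ {Δ = Δ₄} (there ∘ hs₃) ⟨ v1 , v0 ⟩))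
        (choose-solution E₄ h3 (left-≈ h2 h1) (right-≈ h2 h1) (hyp′ h3) (hyp′ h1)
          (∧E₁′ (hyp′ h0)) (∧E₂′ (hyp′ h0)) (hyp′ h2)))

    ATRˢᵗ⊃UATRˢᵗ : Δ ⊩ ATRˢᵗ ⊃′ UATRˢᵗ
    ATRˢᵗ⊃UATRˢᵗ = ATRˢᵗ⊃Candidates ⨾ Candidates⊃UATRˢᵗ

  -- Standard search operator and characteristic functions from (∃²)

  withChar : Formula (signature F) triple → List (Sch Γ) → List (Sch (Fn ∷ Γ))
  withChar A Δ = Charˢᵗ A h0 ∷ Char A h0 ∷ ⌜ st v0 ⌝ ∷ map ↑′ Δ

  old : {A : Formula (signature F) triple} {B : Sch Γ} {Δ : List (Sch Γ)} →
        B ∈ Δ → ↑′ B ∈ withChar A Δ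
  old x = there (there (there (∈-map⁺ ↑′ x)))

  withChar-standard : {A : Formula (signature F) triple} {Δ : List (Sch Γ)} →
                      AllStandard Δ → AllStandard (withChar A Δ)
  withChar-standard hs x = there (there (consˢᵗ hs x))

  withCharE : {A : Formula (signature F) triple} → Arithmetical A → {e m : 𝟐 ∈ Γ} →
              ⌜ Decides= e ⌝ ∈ Δ → ⌜ FindsZero m ⌝ ∈ Δ → AllStandard Δ →
              withChar A Δ ⊩ ↑′ C → Δ ⊩ C
  withCharE {A = A} a he hm hs q = ∃ˢᵗE (∃-Char A a _ _ he hm hs)
    (⊃E′ (⊃E′ (weaken′ there (⊃I′ (⊃I′ q))) (∧E₁′ (hyp′ h0))) (∧E₂′ (hyp′ h0)))

  Δ₀ : List (Sch (𝟐 ∷ 𝟐 ∷ []))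
  Δ₀ = ⌜ FindsZero h0 ⌝ ∷ ⌜ st v0 ⌝ ∷ ⌜ Decides= h1 ⌝ ∷ ⌜ st v1 ⌝ ∷ []

  Δ₁ : List (Sch (Fn ∷ 𝟐 ∷ 𝟐 ∷ []))
  Δ₁ = withChar L Δ₀

  Δ₂ : List (Sch (Fn ∷ Fn ∷ 𝟐 ∷ 𝟐 ∷ []))
  Δ₂ = withChar D Δ₁

  Δ₃ : List (Sch (Fn ∷ Fn ∷ Fn ∷ 𝟐 ∷ 𝟐 ∷ []))
  Δ₃ = withChar P Δ₂

  standard₀ : AllStandard Δ₀
  standard₀ h0 = h1
  standard₀ h1 = h3

  standard₁ : AllStandard Δ₁
  standard₁ = withChar-standard {A = L} {Δ₀} standard₀

  standard₂ : AllStandard Δ₂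
  standard₂ = withChar-standard {A = D} {Δ₁} standard₁

  standard₃ : AllStandard Δ₃
  standard₃ = withChar-standard {A = P} {Δ₂} standard₂

  old₁ : {B : Sch (𝟐 ∷ 𝟐 ∷ [])} → B ∈ Δ₀ → ↑′ B ∈ Δ₁
  old₁ = old {A = L} {Δ = Δ₀}

  old₂ : {B : Sch (Fn ∷ 𝟐 ∷ 𝟐 ∷ [])} → B ∈ Δ₁ → ↑′ B ∈ Δ₂
  old₂ = old {A = D} {Δ = Δ₁}

  old₃ : {B : Sch (Fn ∷ Fn ∷ 𝟐 ∷ 𝟐 ∷ [])} → B ∈ Δ₂ → ↑′ B ∈ Δ₃
  old₃ = old {A = P} {Δ = Δ₂}

  E₃ : Parameters Δ₃
  E₃ = record
    { m = h3 ; l = h2 ; d = h1 ; p = h0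
    ; finds = old₃ {⌜ FindsZero h2 ⌝} (old₂ {⌜ FindsZero h1 ⌝} (old₁ {⌜ FindsZero h0 ⌝} h0))
    ; char-L = old₃ {Char L h1} (old₂ {Char L h0} h1) ; char-D = old₃ {Char D h0} h1 ; char-P = h1
    ; charˢᵗ-L = old₃ {Charˢᵗ L h1} (old₂ {Charˢᵗ L h0} h0)
    ; charˢᵗ-D = old₃ {Charˢᵗ D h0} h0 ; charˢᵗ-P = h0 }

  module _ (∃²-holds : ∀ {Γ} {Δ : List (Formula (signature F) Γ)} → T ∣ Δ ⊢ closed ∃²) where

    -- The conclusion is a sentence, so the parameters can be discharged. Transfer makes the
    -- equality test and the search operator standard, and the characteristic functions are terms
    -- built from these two.
    parametersE : {C : Sch []} → Δ₃ ⊩ ↑′ (↑′ (↑′ (↑′ (↑′ C)))) → [] ⊩ C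
    parametersE q = ∃ˢᵗE {A = ⌜ Decides= h0 ⌝}
      (⊩I (⊃E (∃ˢᵗ-transfer (Decides= h0) _) ∃-Decides=))
      (∃ˢᵗE {A = ⌜ FindsZero h0 ⌝} (⊩I (⊃E (∃ˢᵗ-transfer (FindsZero h0) _) (∃-FindsZero ∃²-holds)))
        (withCharE {Δ = Δ₀} {A = L} L-arithmetical h2 h0 standard₀
          (withCharE {Δ = Δ₁} {A = D} D-arithmetical (old₁ {⌜ Decides= h1 ⌝} h2)
            (old₁ {⌜ FindsZero h0 ⌝} h0) standard₁
            (withCharE {Δ = Δ₂} {A = P} P-arithmetical
              (old₂ {⌜ Decides= h2 ⌝} (old₁ {⌜ Decides= h1 ⌝} h2))
              (old₂ {⌜ FindsZero h1 ⌝} (old₁ {⌜ FindsZero h0 ⌝} h0)) standard₂ q))))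

    ATRˢᵗ⇔UATRˢᵗ : [] ⊩ ATRˢᵗ ⇔′ UATRˢᵗ
    ATRˢᵗ⇔UATRˢᵗ = parametersE (∧I′ (ATRˢᵗ⊃UATRˢᵗ E₃ standard₃) (UATRˢᵗ⊃ATRˢᵗ standard₃))

    -- The hub is the existence of a choice functional Ψ: `ATR′` and `ATR*′` lead to it, and it
    -- gives `UATR′` and `ATRˢᵗ`. From these, `UATR′` leads back to `ATR′`, and `ATRˢᵗ` to `ATR*′`.
    all-equivalent : (∀ {Γ A} → QF-AC (signature F) 𝟏 𝟏 Γ A → T Γ A) →
      [] ⊩ (ATR′ ⇔′ UATR′) ∧′ (UATR′ ⇔′ ATRˢᵗ) ∧′ (ATRˢᵗ ⇔′ UATRˢᵗ) ∧′ (UATRˢᵗ ⇔′ ATR*′)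
    all-equivalent ac = parametersE (∧I′
      (∧I′ (ATR⊃Ψ ⨾ Ψ⊃UATR) UATR⊃ATR) (∧I′
      (∧I′ (UATR⊃ATR ⨾ ATR⊃Ψ ⨾ Ψ⊃ATRˢᵗ) (ATRˢᵗ⊃ATR* E₃ standard₃ ⨾ ATR*⊃Ψ ⨾ Ψ⊃UATR)) (∧I′
      (∧I′ ATRˢᵗ⊃UATRˢᵗ₁ UATRˢᵗ⊃ATRˢᵗ₁)
      (∧I′ (UATRˢᵗ⊃ATRˢᵗ₁ ⨾ ATRˢᵗ⊃ATR* E₃ standard₃)
        (ATR*⊃Ψ ⨾ Ψ⊃ATRˢᵗ ⨾ ATRˢᵗ⊃UATRˢᵗ₁)))))
      where
      ATR⊃Ψ : Δ₃ ⊩ ATR′ ⊃′ ∃′ (𝟏 ⇒ 𝟏) (Solution E₃)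
      ATR⊃Ψ = ATR⊃AllSolvable E₃ ⨾ AllSolvable⊃Solution ac E₃
      ATR*⊃Ψ : Δ₃ ⊩ ATR*′ ⊃′ ∃′ (𝟏 ⇒ 𝟏) (Solution E₃)
      ATR*⊃Ψ = ATR*⊃AllSolvable E₃ standard₃ ⨾ AllSolvable⊃Solution ac E₃
      Ψ⊃UATR : Δ₃ ⊩ ∃′ (𝟏 ⇒ 𝟏) (Solution E₃) ⊃′ UATR′
      Ψ⊃UATR = Solution⊃UATR E₃
      Ψ⊃ATRˢᵗ : Δ₃ ⊩ ∃′ (𝟏 ⇒ 𝟏) (Solution E₃) ⊃′ ATRˢᵗ
      Ψ⊃ATRˢᵗ = Solution-transfer E₃ ⨾ Solution⊃ATRˢᵗ E₃ standard₃
      ATRˢᵗ⊃UATRˢᵗ₁ : Δ₃ ⊩ ATRˢᵗ ⊃′ UATRˢᵗ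
      ATRˢᵗ⊃UATRˢᵗ₁ = ATRˢᵗ⊃UATRˢᵗ E₃ standard₃
      UATRˢᵗ⊃ATRˢᵗ₁ : Δ₃ ⊩ UATRˢᵗ ⊃′ ATRˢᵗ
      UATRˢᵗ⊃ATRˢᵗ₁ = UATRˢᵗ⊃ATRˢᵗ standard₃

-- Instantiation with linear orders, descents and hierarchies

isOrder descends isHierarchy : Formula Sg triple
isOrder     = LO v1
descends    = ∀̇ o (LT v2 (v1 · ṡ v0) (v1 · v0))
isHierarchy = H v2 v1 v0

module _ (F : Functionals) (T : Theory (signature F)) (Ω : ∀ {Γ A} → RCA₀Ω F Γ A → T Γ A)
         (∃²-holds : ∀ {Γ} {Δ : List (Formula (signature F) Γ)} → T ∣ Δ ⊢ closed ∃²) where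

  -- All quantifiers of the three formulas range over numbers, so `Arithmetical` reduces to products
  -- of unit types, whose inhabitants are inferred.
  open Equivalences F T Ω isOrder descends isHierarchy _ _ _

  private
    -- On concrete formulas the substitutions in the atoms compute, so each of the five schemata
    -- unfolds to the intended sentence.
    ATR≡ : ⌊ ATR′ ⌋ ≡ ATR
    ATR≡ = refl

    UATR≡ : ⌊ UATR′ ⌋ ≡ UATR
    UATR≡ = refl

    ATRˢᵗ≡ : ⌊ ATRˢᵗ ⌋ ≡ ATR ˢᵗ
    ATRˢᵗ≡ = refl

    UATRˢᵗ≡ : ⌊ UATRˢᵗ ⌋ ≡ UATR ˢᵗ
    UATRˢᵗ≡ = refl

    ATR*≡ : ⌊ ATR*′ ⌋ ≡ ATR*
    ATR*≡ = refl

    _⇔≡_ : {A A′ B B′ : Sentence (signature F)} → A ≡ A′ → B ≡ B′ → (A ⇔ B) ≡ (A′ ⇔ B′)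
    _⇔≡_ = cong₂ _⇔_

  standard-equivalence : T ⊢ ATR ˢᵗ ⇔ UATR ˢᵗ
  standard-equivalence = subst (T ⊢_) (ATRˢᵗ≡ ⇔≡ UATRˢᵗ≡) (⊩E (ATRˢᵗ⇔UATRˢᵗ ∃²-holds))

  full-equivalence : (∀ {Γ A} → QF-AC (signature F) 𝟏 𝟏 Γ A → T Γ A) →
    T ⊢ (ATR ⇔ UATR) ∧ (UATR ⇔ ATR ˢᵗ) ∧ (ATR ˢᵗ ⇔ UATR ˢᵗ) ∧ (UATR ˢᵗ ⇔ ATR*)
  full-equivalence ac = subst (T ⊢_)
    (cong₂ _∧_ (ATR≡ ⇔≡ UATR≡) (cong₂ _∧_ (UATR≡ ⇔≡ ATRˢᵗ≡)
      (cong₂ _∧_ (ATRˢᵗ≡ ⇔≡ UATRˢᵗ≡) (UATRˢᵗ≡ ⇔≡ ATR*≡))))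
    (⊩E (all-equivalent ∃²-holds ac))

theorem6p1 : (F : Functionals) →
    (RCA₀Ω F ⊕ ⟪ ∃² ⟫ ⊢ ATR ˢᵗ ⇔ UATR ˢᵗ)
    × (RCA₀Ω F ⊕ QF-AC (signature F) 𝟏 𝟏 ⊕ ⟪ ∃² ⟫ ⊢
    (ATR ⇔ UATR) ∧ (UATR ⇔ ATR ˢᵗ) ∧ (ATR ˢᵗ ⇔ UATR ˢᵗ) ∧ (UATR ˢᵗ ⇔ ATR*))
theorem6p1 F =
  standard-equivalence F _ inj₁ (axiom (inj₂ refl)) ,
  full-equivalence F _ (λ a → inj₁ (inj₁ a)) (axiom (inj₂ refl)) (λ a → inj₁ (inj₂ a))
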